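{- Let $n=2^e p_1^{e_1}\cdots p_r^{e_r}\ge 2$ with $e\ge0$, $p_1,\dots,p_r$ distinct odd primes, $e_i\ge1$ (and $r\ge1$ if $e=0$). Let $A_1$, $A_0$, $K_n$ be as in the context. If $e=0$, the map $\rho_1:A_1\to K_n$ sending $(a_1,\dots,a_r)$ to the class modulo $w(n)$ of a solution $k$ of $x\equiv a_1\pmod{l_1},\dots,x\equiv a_r\pmod{l_r}$ is a (well-defined) bijection. If $e\ge1$, the map $\rho_0:A_0\to K_n$ sending $(a_0,a_1,\dots,a_r)$ to the class modulo $w(n)$ of a solution $k$ of $x\equiv a_0\pmod{l_0}, x\equiv a_1\pmod{l_1},\dots,x\equiv a_r\pmod{l_r}$ is a (well-defined) bijection.
   Context: For an integer $k\ge 1$, $D_k(x)=\sum_{j=0}^{\lfloor k/2\rfloor}\frac{k}{k-j}\binom{k-j}{j}(-1)^j x^{k-2j}$. Put $l_i=p_i^{e_i-1}\frac{p_i^2-1}{2}$ for $i=1,\dots,r$; if $e\ge1$, $l_0=3\cdot2^{e-1}$ if $1\le e<3$ and $l_0=3\cdot2^{e-2}$ if $e\ge3$. Let $w(n)=\mathrm{lcm}(l_1,\dots,l_r)$ if $e=0$ and $w(n)=\mathrm{lcm}(l_0,l_1,\dots,l_r)$ if $e\ge1$. For a modulus $q$ and an integer $L$ such that $D_k(u)\bmod q$ depends only on $k\bmod L$ (this holds for $(q,L)=(n,w(n))$, $(2^e,l_0)$ and $(p_i^{e_i},l_i)$), the kernel is the set of classes $k\in\mathbb{Z}_L^*$ with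 $D_k(u)\equiv u\pmod q$ for all integers $u$. So $K_n\subseteq\mathbb{Z}_{w(n)}^*$, $K_{2^e}\subseteq\mathbb{Z}_{l_0}^*$, $K_{p_i^{e_i}}\subseteq\mathbb{Z}_{l_i}^*$ (equivalently $K_n$ is the kernel of $\mathbb{Z}_{w(n)}^*\to G_n$, $k\mapsto(u\mapsto D_k(u))$, $G_n$ being the group of permutations of $\mathbb{Z}_n$ induced by Dickson permutation polynomials). Define $A_1=\{(a_1,\dots,a_r)\in K_{p_1^{e_1}}\times\cdots\times K_{p_r^{e_r}}:\ \text{the system } x\equiv a_i\pmod{l_i}\ (1\le i\le r)\text{ has a solution}\}$ and $A_0=\{(a_0,\dots,a_r)\in K_{2^e}\times K_{p_1^{e_1}}\times\cdots\times K_{p_r^{e_r}}:\ \text{the system } x\equiv a_i\pmod{l_i}\ (0\le i\le r)\text{ has a solution}\}$, where the congruences are understood for representatives of the classes $a_i$. -}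

module Defs where

open import Data.Nat as ℕ using (ℕ; zero; suc; _*_; _∸_; _^_; _<_; _/_)
open import Data.Nat.Combinatorics using (_C_)
open import Data.Nat.Coprimality using (Coprime)
open import Data.Nat.LCM using (lcm)
open import Data.Integer as ℤ using (ℤ; +_)
open import Data.Integer.Divisibility using () renaming (_∣_ to _∣ℤ_)
open import Data.Fin using (Fin; zero; suc)
open import Data.Product using (Σ; ∃; _×_)
open import Relation.Binary.PropositionalEquality using (_≡_)

-- Coefficient  k/(k-j) * binom(k-j, j)  of the Dickson polynomial, computed as
-- the exact quotient (k * binom(k-j,j)) / (k-j); only used for j ≤ ⌊k/2⌋, k ≥ 1,
-- where k - j ≥ 1 (the value 0 for k - j = 0 is an unused default).
dicksonCoef : ℕ → ℕ → ℕ
dicksonCoef k j with k ∸ j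
... | zero  = 0
... | suc m = (k * ((k ∸ j) C j)) / suc m

sumUpTo : ℕ → (ℕ → ℤ) → ℤ
sumUpTo zero    f = f 0
sumUpTo (suc m) f = sumUpTo m f ℤ.+ f (suc m)

D : ℕ → ℤ → ℤ
D k x = sumUpTo (k / 2) (λ j →
  ((ℤ.- ℤ.1ℤ) ℤ.^ j) ℤ.* (+ dicksonCoef k j) ℤ.* (x ℤ.^ (k ∸ 2 * j)))

_≡_[modℤ_] : ℤ → ℤ → ℕ → Set
a ≡ b [modℤ m ] = (+ m) ∣ℤ (a ℤ.- b)

_≡_[modℕ_] : ℕ → ℕ → ℕ → Set
a ≡ b [modℕ m ] = (+ a) ≡ (+ b) [modℤ m ]

-- Kernel for modulus q and period L: classes of Z_L^* (canonical representative
-- k with k < L, gcd(k,L)=1) such that D_k(u) ≡ u (mod q) for all integers u.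
Kernel : ℕ → ℕ → ℕ → Set
Kernel q L k = k < L × Coprime k L × (∀ (u : ℤ) → D k u ≡ u [modℤ q ])

lp : ℕ → ℕ → ℕ
lp p f = p ^ (f ∸ 1) * ((p * p ∸ 1) / 2)

-- l_0 = 3·2^(e-1) if 1 ≤ e < 3, 3·2^(e-2) if e ≥ 3 (value at e = 0 unused)
l0 : ℕ → ℕ
l0 zero = 1
l0 (suc zero) = 3
l0 (suc (suc zero)) = 6
l0 (suc (suc (suc m))) = 3 * 2 ^ suc m

lcmF : (m : ℕ) → (Fin m → ℕ) → ℕ
lcmF zero    f = 1
lcmF (suc m) f = lcm (f zero) (lcmF m (λ i → f (suc i)))

prodF : (m : ℕ) → (Fin m → ℕ) → ℕ
prodF zero    f = 1
prodF (suc m) f = f zero * prodF m (λ i → f (suc i))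

nOf : ℕ → (r : ℕ) → (Fin r → ℕ) → (Fin r → ℕ) → ℕ
nOf e r p es = 2 ^ e * prodF r (λ i → p i ^ es i)

w : ℕ → (r : ℕ) → (Fin r → ℕ) → (Fin r → ℕ) → ℕ
w zero    r p es = lcmF r (λ i → lp (p i) (es i))
w (suc e) r p es = lcm (l0 (suc e)) (lcmF r (λ i → lp (p i) (es i)))

Solves : (m : ℕ) → (Fin m → ℕ) → (Fin m → ℕ) → ℕ → Set
Solves m L a x = ∀ i → x ≡ a i [modℕ L i ]

A : (m : ℕ) → (q L : Fin m → ℕ) → Set
A m q L = Σ (Fin m → ℕ) (λ a → (∀ i → Kernel (q i) (L i) (a i)) × ∃ (Solves m L a))

K : (n W : ℕ) → Set
K n W = Σ ℕ (Kernel n W)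

{-# OPTIONS --safe #-}

-- Write V_k for the Dickson polynomials and U_k for the Lucas sequence with the same recurrence
-- X_{k+2} = u X_{k+1} - X_k, started at 0, 1. Everything rests on
--   V_{k+2m} - V_k = (u² - 4) U_{k+m} U_m,
-- which turns the periods l_i into divisibility of (u² - 4) U_{k+m} U_m with 2m = l_i.
-- For an odd prime p = 2h + 1, the explicit formula and Fermat give V_p ≡ u mod p, that is
-- p | (u² - 4) U_{h+1} U_h, so p | (u² - 4) U_m for m = h (h + 1) = (p² - 1) / 4. Since
-- U_{pm}(u) = U_m(u) U_p(V_m(u)), V_m² - 4 = (u² - 4) U_m² and U_p(v) ≡ p modulo v² - 4,
-- replacing m by pm gains a factor p. For powers of two the gain comes from U_{2m} = U_m V_m
-- with V_m even when 3 | m. Modulo 2^e with e ≥ 3 the period holds only for odd k, which is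
-- enough because kernel elements are units modulo l_0.
-- Given the periods, a solution of the system lies in K_n iff its residues lie in the local
-- kernels, and the bijection is the uniqueness of solutions modulo the lcm of the l_i.
module Submission where

open import Defs

module DicksonKernels where

  open import Data.Nat as ℕ using (ℕ; zero; suc; NonZero)
  import Data.Nat.Properties as ℕ
  import Data.Nat.Divisibility as ℕ
  import Data.Nat.DivMod as ℕ
  open import Data.Nat.Combinatorics using (_C_; nCk+nC[k+1]≡[n+1]C[k+1]; k>n⇒nCk≡0; nC1≡n; nCn≡1)
  import Data.Nat.Coprimality as Coprimality
  open import Data.Nat.Coprimality using (Coprime; coprime-+; coprime-divisor)
  open import Data.Nat.LCM using (m∣lcm[m,n]; n∣lcm[m,n]; lcm-least)
  open import Data.Nat.Primality using (Prime; prime[2]; ¬prime[1]; prime⇒irreducible; prime⇒nonZero; euclidsLemma)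
  open import Data.Nat.Tactic.RingSolver using () renaming (solve-∀ to solve-∀ℕ)
  open import Data.Integer as ℤ using (ℤ; +_; -[1+_]; _+_; _-_; _*_; -_; _^_)
  import Data.Integer.Properties as ℤ
  open import Data.Integer.DivMod using (_/ℕ_; _%ℕ_; n%ℕd<d; a≡a%ℕn+[a/ℕn]*n)
  open import Data.Integer.Divisibility.Signed
  open import Data.Integer.Tactic.RingSolver using (solve-∀)
  open import Data.Fin using (Fin; zero; suc)
  import Data.Fin.Properties as Fin
  open import Data.Vec.Functional using (_∷_)
  open import Data.Product using (Σ; ∃; _×_; _,_; proj₁; proj₂)
  open import Data.Sum using (_⊎_; inj₁; inj₂; map)
  open import Data.Empty using (⊥-elim)
  open import Function using (_∘_)
  open import Function.Definitions using (Injective)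
  open import Relation.Nullary using (¬_; yes; no)
  open import Relation.Binary.PropositionalEquality using (_≡_; _≢_; refl; sym; trans; cong; cong₂; subst; module ≡-Reasoning)

  -- Lucas sequences

  pos-∣ : ∀ {m n} → m ℕ.∣ n → + m ∣ + n
  pos-∣ = ∣ᵤ⇒∣

  U : ℤ → ℕ → ℤ
  U u zero          = + 0
  U u (suc zero)    = + 1
  U u (suc (suc n)) = u * U u (suc n) - U u n

  V : ℤ → ℕ → ℤ
  V u zero          = + 2
  V u (suc zero)    = u
  V u (suc (suc n)) = u * V u (suc n) - V u n

  module _ (u : ℤ) (X : ℕ → ℤ) (rec : ∀ n → X (suc (suc n)) ≡ u * X (suc n) - X n) where

    -- Both sides obey the same recurrence in `m`, so agreement at two consecutive values
    -- propagates. Keeping `X` general makes one induction serve both `U` and `V`.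
    X-shift-suc : ∀ m a → X (suc (m ℕ.+ a)) ≡ U u (suc m) * X (suc a) - U u m * X a
    X-shift-suc zero a = lemma (X (suc a)) (X a)
      where
      lemma : ∀ y x → y ≡ + 1 * y - + 0 * x
      lemma = solve-∀
    X-shift-suc (suc zero) a = trans (rec a) (lemma u (X (suc a)) (X a))
      where
      lemma : ∀ u y x → u * y - x ≡ (u * + 1 - + 0) * y - + 1 * x
      lemma = solve-∀
    X-shift-suc (suc (suc m)) a = begin
      X (suc (suc (suc m) ℕ.+ a))                       ≡⟨ rec (suc m ℕ.+ a) ⟩
      u * X (suc (suc m ℕ.+ a)) - X (suc (m ℕ.+ a))     ≡⟨ cong₂ (λ x y → u * x - y) (X-shift-suc (suc m) a) (X-shift-suc m a) ⟩
      u * ((u * t - s) * y - t * x) - (t * y - s * x)   ≡⟨ lemma u s t x y ⟩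
      (u * (u * t - s) - t) * y - (u * t - s) * x       ∎
      where
      open ≡-Reasoning
      s t x y : ℤ
      s = U u m
      t = U u (suc m)
      x = X a
      y = X (suc a)
      lemma : ∀ u s t x y → u * ((u * t - s) * y - t * x) - (t * y - s * x)
                            ≡ (u * (u * t - s) - t) * y - (u * t - s) * x
      lemma = solve-∀

    -- The factor `u * U u m - U u (suc m)` stands for U_{m-1}; writing it this way avoids an index
    -- below zero when `m` is 0.
    X-shift : ∀ m a → X (m ℕ.+ a) ≡ U u m * X (suc a) - (u * U u m - U u (suc m)) * X a
    X-shift zero a = lemma u (X (suc a)) (X a)
      where
      lemma : ∀ u y x → x ≡ + 0 * y - (u * + 0 - + 1) * x
      lemma = solve-∀
    X-shift (suc m) a = trans (X-shift-suc m a) (lemma u (U u m) (U u (suc m)) (X a) (X (suc a)))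
      where
      lemma : ∀ u s t x y → t * y - s * x ≡ t * y - (u * t - (u * t - s)) * x
      lemma = solve-∀

  U-shift-suc : ∀ u m a → U u (suc (m ℕ.+ a)) ≡ U u (suc m) * U u (suc a) - U u m * U u a
  U-shift-suc u = X-shift-suc u (U u) (λ _ → refl)

  U-shift : ∀ u m a → U u (m ℕ.+ a) ≡ U u m * U u (suc a) - (u * U u m - U u (suc m)) * U u a
  U-shift u = X-shift u (U u) (λ _ → refl)

  V≡2U-uU : ∀ u n → V u n ≡ + 2 * U u (suc n) - u * U u n
  V≡2U-uU u n = begin
    V u n                                              ≡⟨ cong (V u) (ℕ.+-identityʳ n) ⟨
    V u (n ℕ.+ 0)                                      ≡⟨ X-shift u (V u) (λ _ → refl) n 0 ⟩
    U u n * u - (u * U u n - U u (suc n)) * + 2        ≡⟨ lemma u (U u n) (U u (suc n)) ⟩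
    + 2 * U u (suc n) - u * U u n                      ∎
    where
    open ≡-Reasoning
    lemma : ∀ u s t → s * u - (u * s - t) * + 2 ≡ + 2 * t - u * s
    lemma = solve-∀

  -- The quadratic form t² - uts + s² is invariant under the step (s, t) ↦ (t, ut - s), and its
  -- value at the start (0, 1) is 1.
  cassini : ∀ u n → let s = U u n; t = U u (suc n) in t * t - u * t * s + s * s ≡ + 1
  cassini u zero    = lemma u
    where
    lemma : ∀ u → + 1 * + 1 - u * + 1 * + 0 + + 0 * + 0 ≡ + 1
    lemma = solve-∀
  cassini u (suc n) = trans (lemma u (U u n) (U u (suc n))) (cassini u n)
    where
    lemma : ∀ u s t → (u * t - s) * (u * t - s) - u * (u * t - s) * t + t * t ≡ t * t - u * t * s + s * s
    lemma = solve-∀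

  -- The ring solver knows nothing of `cassini`. Identities that depend on it are therefore proved
  -- with an explicit multiple of the vanishing expression added, which this lemma then removes.
  modulo-cassini : ∀ u n x → let s = U u n; t = U u (suc n) in
                   ∀ y → y + (t * t - u * t * s + s * s - + 1) * x ≡ y
  modulo-cassini u n x y rewrite cassini u n = lemma x y
    where
    lemma : ∀ x y → y + (+ 1 - + 1) * x ≡ y
    lemma = solve-∀

  -- With u = y + 1/y one has V_k = y^k + y^(-k) and U_k = (y^k - y^(-k)) / (y - 1/y), and the
  -- identity is the factorisation of y^(k+2m) + y^(-k-2m) - y^k - y^(-k). The proof stays over the
  -- integers: everything is expressed through U_m, U_{m+1}, U_k, U_{k+1}, and the two sides differ
  -- by a multiple of the Cassini relation.
  V-difference : ∀ u m k → V u (m ℕ.+ (m ℕ.+ k)) - V u k ≡ (u * u - + 4) * U u (m ℕ.+ k) * U u m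
  V-difference u m k = begin
    V u (m ℕ.+ (m ℕ.+ k)) - V u k
      ≡⟨ cong₂ _-_ (V≡2U-uU u (m ℕ.+ (m ℕ.+ k))) (V≡2U-uU u k) ⟩
    + 2 * U u (suc (m ℕ.+ (m ℕ.+ k))) - u * U u (m ℕ.+ (m ℕ.+ k)) - (+ 2 * b - u * a)
      ≡⟨ cong₂ (λ x y → + 2 * x - u * y - (+ 2 * b - u * a)) (U-shift-suc u m (m ℕ.+ k)) (U-shift u m (m ℕ.+ k)) ⟩
    + 2 * (t * U u (suc (m ℕ.+ k)) - s * U u (m ℕ.+ k)) - u * (s * U u (suc (m ℕ.+ k)) - (u * s - t) * U u (m ℕ.+ k)) - (+ 2 * b - u * a)
      ≡⟨ cong₂ (λ x y → + 2 * (t * x - s * y) - u * (s * x - (u * s - t) * y) - (+ 2 * b - u * a)) (U-shift-suc u m k) (U-shift u m k) ⟩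
    + 2 * (t * b₁ - s * a₁) - u * (s * b₁ - (u * s - t) * a₁) - (+ 2 * b - u * a)
      ≡⟨ lemma u s t a b ⟩
    (u * u - + 4) * a₁ * s + (t * t - u * t * s + s * s - + 1) * (+ 2 * b - u * a)
      ≡⟨ modulo-cassini u m (+ 2 * b - u * a) _ ⟩
    (u * u - + 4) * a₁ * s
      ≡⟨ cong (λ x → (u * u - + 4) * x * s) (U-shift u m k) ⟨
    (u * u - + 4) * U u (m ℕ.+ k) * s ∎
    where
    open ≡-Reasoning
    s t a b a₁ b₁ : ℤ
    s = U u m
    t = U u (suc m)
    a = U u k
    b = U u (suc k)
    a₁ = s * b - (u * s - t) * a
    b₁ = t * b - s * a
    lemma : ∀ u s t a b →
      + 2 * (t * (t * b - s * a) - s * (s * b - (u * s - t) * a))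
        - u * (s * (t * b - s * a) - (u * s - t) * (s * b - (u * s - t) * a)) - (+ 2 * b - u * a)
      ≡ (u * u - + 4) * (s * b - (u * s - t) * a) * s + (t * t - u * t * s + s * s - + 1) * (+ 2 * b - u * a)
    lemma = solve-∀

  -- This says that along an arithmetic progression of step `m` the sequence U again satisfies the
  -- recurrence, with parameter `V u m` in place of `u`.
  U-double-shift : ∀ u m a → U u (m ℕ.+ (m ℕ.+ a)) ≡ V u m * U u (m ℕ.+ a) - U u a
  U-double-shift u m a = begin
    U u (m ℕ.+ (m ℕ.+ a))
      ≡⟨ U-shift u m (m ℕ.+ a) ⟩
    s * U u (suc (m ℕ.+ a)) - (u * s - t) * U u (m ℕ.+ a)
      ≡⟨ cong₂ (λ x y → s * x - (u * s - t) * y) (U-shift-suc u m a) (U-shift u m a) ⟩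
    s * (t * y - s * x) - (u * s - t) * (s * y - (u * s - t) * x)
      ≡⟨ lemma u s t x y ⟩
    (+ 2 * t - u * s) * (s * y - (u * s - t) * x) - x + (t * t - u * t * s + s * s - + 1) * (- x)
      ≡⟨ modulo-cassini u m (- x) _ ⟩
    (+ 2 * t - u * s) * (s * y - (u * s - t) * x) - x
      ≡⟨ cong₂ (λ p q → p * q - x) (V≡2U-uU u m) (U-shift u m a) ⟨
    V u m * U u (m ℕ.+ a) - U u a ∎
    where
    open ≡-Reasoning
    s t x y : ℤ
    s = U u m
    t = U u (suc m)
    x = U u a
    y = U u (suc a)
    lemma : ∀ u s t x y →
      s * (t * y - s * x) - (u * s - t) * (s * y - (u * s - t) * x)
      ≡ (+ 2 * t - u * s) * (s * y - (u * s - t) * x) - x + (t * t - u * t * s + s * s - + 1) * (- x)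
    lemma = solve-∀

  -- By `U-double-shift` the multiples of `m` index a sequence with parameter `V u m` and initial
  -- values 0 and `U u m`, which is `U u m` times the Lucas sequence of that parameter.
  U-* : ∀ u m n → U u (n ℕ.* m) ≡ U u m * U (V u m) n
  U-* u m zero          = sym (ℤ.*-zeroʳ (U u m))
  U-* u m (suc zero)    = trans (cong (U u) (ℕ.+-identityʳ m)) (sym (ℤ.*-identityʳ (U u m)))
  U-* u m (suc (suc n)) = begin
    U u (m ℕ.+ (m ℕ.+ n ℕ.* m))                        ≡⟨ U-double-shift u m (n ℕ.* m) ⟩
    V u m * U u (suc n ℕ.* m) - U u (n ℕ.* m)          ≡⟨ cong₂ (λ x y → V u m * x - y) (U-* u m (suc n)) (U-* u m n) ⟩
    v * (s * U v (suc n)) - s * U v n                  ≡⟨ lemma v s (U v n) (U v (suc n)) ⟩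
    s * (v * U v (suc n) - U v n)                      ∎
    where
    open ≡-Reasoning
    s v : ℤ
    s = U u m
    v = V u m
    lemma : ∀ v s x y → v * (s * y) - s * x ≡ s * (v * y - x)
    lemma = solve-∀

  U∣U-* : ∀ u m n → U u m ∣ U u (n ℕ.* m)
  U∣U-* u m n = subst (U u m ∣_) (sym (U-* u m n)) (∣m⇒∣m*n (U (V u m) n) ∣-refl)

  -- In the notation u = y + 1/y this is (y^m + y^(-m))² - 4 = (y^m - y^(-m))². It transfers
  -- divisibility from U_m to the discriminant of the parameter `V u m`.
  V²-4 : ∀ u m → V u m * V u m - + 4 ≡ (u * u - + 4) * U u m * U u m
  V²-4 u m = begin
    V u m * V u m - + 4                              ≡⟨ cong (λ x → x * x - + 4) (V≡2U-uU u m) ⟩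
    (+ 2 * t - u * s) * (+ 2 * t - u * s) - + 4      ≡⟨ lemma u s t ⟩
    (u * u - + 4) * s * s + (t * t - u * t * s + s * s - + 1) * + 4 ≡⟨ modulo-cassini u m (+ 4) _ ⟩
    (u * u - + 4) * s * s                            ∎
    where
    open ≡-Reasoning
    s t : ℤ
    s = U u m
    t = U u (suc m)
    lemma : ∀ u s t → (+ 2 * t - u * s) * (+ 2 * t - u * s) - + 4
                      ≡ (u * u - + 4) * s * s + (t * t - u * t * s + s * s - + 1) * + 4
    lemma = solve-∀

  -- The difference of consecutive odd-indexed terms is V u (2h + 2), which is 2 modulo u² - 4.
  u²-4∣U-odd : ∀ u h → (u * u - + 4) ∣ (U u (suc (h ℕ.+ h)) - + suc (h ℕ.+ h))
  u²-4∣U-odd u zero    = divides (+ 0) refl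
  u²-4∣U-odd u (suc h) = subst ((u * u - + 4) ∣_) (sym eq)
    (∣m∣n⇒∣m+n (u²-4∣U-odd u h) (∣m⇒∣m*n (U u (suc h)) (∣m⇒∣m*n (U u (suc h)) ∣-refl)))
    where
    open ≡-Reasoning
    j : ℕ
    j = h ℕ.+ h
    V-even : V u (suc (suc j)) - + 2 ≡ (u * u - + 4) * U u (suc h) * U u (suc h)
    V-even = begin
      V u (suc (suc j)) - + 2
        ≡⟨ cong (λ n → V u n - + 2) (trans (cong suc (sym (ℕ.+-suc h h))) (cong (suc h ℕ.+_) (sym (ℕ.+-identityʳ (suc h))))) ⟩
      V u (suc h ℕ.+ (suc h ℕ.+ 0)) - + 2
        ≡⟨ V-difference u (suc h) 0 ⟩
      (u * u - + 4) * U u (suc h ℕ.+ 0) * U u (suc h)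
        ≡⟨ cong (λ n → (u * u - + 4) * U u n * U u (suc h)) (ℕ.+-identityʳ (suc h)) ⟩
      (u * u - + 4) * U u (suc h) * U u (suc h) ∎
    lemma : ∀ u s t n → u * (u * t - s) - t - (+ 2 + n) ≡ t - n + (+ 2 * (u * (u * t - s) - t) - u * (u * t - s) - + 2)
    lemma = solve-∀
    eq : U u (suc (suc h ℕ.+ suc h)) - + suc (suc h ℕ.+ suc h)
         ≡ (U u (suc j) - + suc j) + (u * u - + 4) * U u (suc h) * U u (suc h)
    eq = begin
      U u (suc (suc h ℕ.+ suc h)) - + suc (suc h ℕ.+ suc h)
        ≡⟨ cong (λ n → U u (suc (suc n)) - + suc (suc n)) (ℕ.+-suc h h) ⟩
      U u (suc (suc (suc j))) - (+ 2 + + suc j)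
        ≡⟨ lemma u (U u j) (U u (suc j)) (+ suc j) ⟩
      (U u (suc j) - + suc j) + (+ 2 * U u (suc (suc (suc j))) - u * U u (suc (suc j)) - + 2)
        ≡⟨ cong (λ x → (U u (suc j) - + suc j) + (x - + 2)) (V≡2U-uU u (suc (suc j))) ⟨
      (U u (suc j) - + suc j) + (V u (suc (suc j)) - + 2)
        ≡⟨ cong (_+_ (U u (suc j) - + suc j)) V-even ⟩
      (U u (suc j) - + suc j) + (u * u - + 4) * U u (suc h) * U u (suc h) ∎

  -- Binomial coefficients and finite sums

  absorption : ∀ n k → suc k ℕ.* (suc n C suc k) ≡ suc n ℕ.* (n C k)
  absorption zero zero = refl
  absorption zero (suc k) = begin
    suc (suc k) ℕ.* (1 C suc (suc k)) ≡⟨ cong (suc (suc k) ℕ.*_) (k>n⇒nCk≡0 (ℕ.s≤s (ℕ.s≤s (ℕ.z≤n {k})))) ⟩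
    suc (suc k) ℕ.* 0                 ≡⟨ ℕ.*-zeroʳ (suc (suc k)) ⟩
    1 ℕ.* 0                           ≡⟨ cong (1 ℕ.*_) (k>n⇒nCk≡0 (ℕ.s≤s (ℕ.z≤n {k}))) ⟨
    1 ℕ.* (0 C suc k)                 ∎
    where open ≡-Reasoning
  absorption (suc n) zero = trans (ℕ.*-identityˡ _) (trans (nC1≡n (suc (suc n))) (sym (ℕ.*-identityʳ _)))
  absorption (suc n) (suc k) = begin
    suc (suc k) ℕ.* (suc (suc n) C suc (suc k))
      ≡⟨ cong (suc (suc k) ℕ.*_) (nCk+nC[k+1]≡[n+1]C[k+1] (suc n) (suc k)) ⟨
    suc (suc k) ℕ.* (a ℕ.+ b)
      ≡⟨ expand k a b ⟩
    a ℕ.+ (suc k ℕ.* a ℕ.+ suc (suc k) ℕ.* b)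
      ≡⟨ cong₂ (λ x y → a ℕ.+ (x ℕ.+ y)) (absorption n k) (absorption n (suc k)) ⟩
    a ℕ.+ (suc n ℕ.* (n C k) ℕ.+ suc n ℕ.* (n C suc k))
      ≡⟨ cong (a ℕ.+_) (ℕ.*-distribˡ-+ (suc n) (n C k) (n C suc k)) ⟨
    a ℕ.+ suc n ℕ.* ((n C k) ℕ.+ (n C suc k))
      ≡⟨ cong (λ x → a ℕ.+ suc n ℕ.* x) (nCk+nC[k+1]≡[n+1]C[k+1] n k) ⟩
    suc (suc n) ℕ.* a ∎
    where
    open ≡-Reasoning
    a b : ℕ
    a = suc n C suc k
    b = suc n C suc (suc k)
    expand : ∀ k a b → suc (suc k) ℕ.* (a ℕ.+ b) ≡ a ℕ.+ (suc k ℕ.* a ℕ.+ suc (suc k) ℕ.* b)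
    expand = solve-∀ℕ

  prime-∣-cancel : ∀ {p} a b → Prime p → a ≢ 0 → a ℕ.< p → p ℕ.∣ a ℕ.* b → p ℕ.∣ b
  prime-∣-cancel a b pr a≢0 a<p p∣ab with euclidsLemma a b pr p∣ab
  ... | inj₂ p∣b = p∣b
  ... | inj₁ p∣a = ⊥-elim (ℕ.<⇒≱ a<p (ℕ.∣⇒≤ {{ℕ.≢-nonZero a≢0}} p∣a))

  sum-cong : ∀ n {f g : ℕ → ℤ} → (∀ j → f j ≡ g j) → sumUpTo n f ≡ sumUpTo n g
  sum-cong zero    f≗g = f≗g 0
  sum-cong (suc n) f≗g = cong₂ _+_ (sum-cong n f≗g) (f≗g (suc n))

  sum-shift : ∀ n (f : ℕ → ℤ) → sumUpTo (suc n) f ≡ f 0 + sumUpTo n (f ∘ suc)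
  sum-shift zero    f = refl
  sum-shift (suc n) f = trans (cong (_+ f (suc (suc n))) (sum-shift n f)) (ℤ.+-assoc (f 0) _ _)

  sum-linear : ∀ n a b (f g : ℕ → ℤ) →
               sumUpTo n (λ j → a * f j + b * g j) ≡ a * sumUpTo n f + b * sumUpTo n g
  sum-linear zero    a b f g = refl
  sum-linear (suc n) a b f g = trans (cong (_+ (a * f (suc n) + b * g (suc n))) (sum-linear n a b f g))
      (lemma a b (sumUpTo n f) (sumUpTo n g) (f (suc n)) (g (suc n)))
    where
    lemma : ∀ a b x y x′ y′ → a * x + b * y + (a * x′ + b * y′) ≡ a * (x + x′) + b * (y + y′)
    lemma = solve-∀

  sum-truncate : ∀ {n} N (f : ℕ → ℤ) → n ℕ.≤ N → (∀ j → n ℕ.< j → f j ≡ + 0) → sumUpTo N f ≡ sumUpTo n f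
  sum-truncate {n} N f n≤N vanish = go (ℕ.≤⇒≤′ n≤N)
    where
    go : ∀ {N} → n ℕ.≤′ N → sumUpTo N f ≡ sumUpTo n f
    go (ℕ.≤′-reflexive refl) = refl
    go (ℕ.≤′-step {N} n≤′N) = trans (cong₂ _+_ (go n≤′N) (vanish (suc N) (ℕ.s≤s (ℕ.≤′⇒≤ n≤′N)))) (ℤ.+-identityʳ _)

  sum-∣ : ∀ {q} n {f : ℕ → ℤ} → (∀ j → j ℕ.≤ n → q ∣ f j) → q ∣ sumUpTo n f
  sum-∣ zero    q∣f = q∣f 0 ℕ.z≤n
  sum-∣ (suc n) q∣f = ∣m∣n⇒∣m+n (sum-∣ n (λ j j≤n → q∣f j (ℕ.m≤n⇒m≤1+n j≤n))) (q∣f (suc n) ℕ.≤-refl)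

  -- Fermat's little theorem

  binomial : ∀ x n → (+ 1 + x) ^ n ≡ sumUpTo n (λ j → + (n C j) * x ^ j)
  binomial x zero    = refl
  binomial x (suc n) = begin
    (+ 1 + x) * (+ 1 + x) ^ n
      ≡⟨ cong ((+ 1 + x) *_) (binomial x n) ⟩
    (+ 1 + x) * sumUpTo n (term n)
      ≡⟨ expand x (sumUpTo n (term n)) ⟩
    sumUpTo n (term n) + x * sumUpTo n (term n)
      -- The first sum is lengthened by the zero term at j = n + 1, so that after splitting off j =
      -- 0 both sums have the same range and Pascal's rule applies termwise.
      ≡⟨ cong (_+ x * sumUpTo n (term n)) (sum-truncate (suc n) (term n) (ℕ.n≤1+n n)
           (λ j n<j → trans (cong (λ c → + c * x ^ j) (k>n⇒nCk≡0 n<j)) (ℤ.*-zeroˡ (x ^ j)))) ⟨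
    sumUpTo (suc n) (term n) + x * sumUpTo n (term n)
      ≡⟨ cong (_+ x * sumUpTo n (term n)) (sum-shift n (term n)) ⟩
    term n 0 + sumUpTo n (term n ∘ suc) + x * sumUpTo n (term n)
      ≡⟨ regroup (term n 0) (sumUpTo n (term n ∘ suc)) x (sumUpTo n (term n)) ⟩
    term n 0 + (+ 1 * sumUpTo n (term n ∘ suc) + x * sumUpTo n (term n))
      ≡⟨ cong (_+_ (term n 0)) (sum-linear n (+ 1) x (term n ∘ suc) (term n)) ⟨
    term n 0 + sumUpTo n (λ j → + 1 * term n (suc j) + x * term n j)
      ≡⟨ cong (_+_ (term n 0)) (sum-cong n pascal) ⟩
    term (suc n) 0 + sumUpTo n (term (suc n) ∘ suc)
      ≡⟨ sum-shift n (term (suc n)) ⟨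
    sumUpTo (suc n) (term (suc n)) ∎
    where
    open ≡-Reasoning
    term : ℕ → ℕ → ℤ
    term n j = + (n C j) * x ^ j
    expand : ∀ x s → (+ 1 + x) * s ≡ s + x * s
    expand = solve-∀
    regroup : ∀ a b x s → a + b + x * s ≡ a + (+ 1 * b + x * s)
    regroup = solve-∀
    collect : ∀ a b x y → + 1 * (b * (x * y)) + x * (a * y) ≡ (a + b) * (x * y)
    collect = solve-∀
    pascal : ∀ j → + 1 * term n (suc j) + x * term n j ≡ term (suc n) (suc j)
    pascal j = begin
      + 1 * (+ (n C suc j) * (x * x ^ j)) + x * (+ (n C j) * x ^ j) ≡⟨ collect (+ (n C j)) (+ (n C suc j)) x (x ^ j) ⟩
      (+ (n C j) + + (n C suc j)) * (x * x ^ j)                     ≡⟨ cong (_* (x * x ^ j)) (ℤ.pos-+ (n C j) (n C suc j)) ⟨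
      + ((n C j) ℕ.+ (n C suc j)) * (x * x ^ j)                     ≡⟨ cong (λ c → + c * (x * x ^ j)) (nCk+nC[k+1]≡[n+1]C[k+1] n j) ⟩
      + (suc n C suc j) * (x * x ^ j)                               ∎

  -- For 0 < j < p absorption gives j * (p C j) = p * (p - 1 C j - 1), and `p` does not divide `j`,
  -- so every middle term of the binomial expansion is divisible by `p`.
  freshman : ∀ p → Prime p → ∀ x → + p ∣ (+ 1 + x) ^ p - (+ 1 + x ^ p)
  freshman (suc (suc n)) pr x = subst (+ p ∣_) (sym eq) (sum-∣ n p∣term)
    where
    open ≡-Reasoning
    p : ℕ
    p = suc (suc n)
    term : ℕ → ℤ
    term j = + (p C j) * x ^ j
    p∣term : ∀ j → j ℕ.≤ n → + p ∣ term (suc j)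
    p∣term j j≤n = ∣m⇒∣m*n (x ^ suc j) (pos-∣ (prime-∣-cancel (suc j) (p C suc j) pr (λ ()) (ℕ.s≤s (ℕ.s≤s j≤n))
      (subst (p ℕ.∣_) (sym (absorption (suc n) j)) (ℕ.m∣m*n (suc n C j)))))
    lemma : ∀ s y → + 1 * + 1 + (s + + 1 * y) - (+ 1 + y) ≡ s
    lemma = solve-∀
    eq : (+ 1 + x) ^ p - (+ 1 + x ^ p) ≡ sumUpTo n (term ∘ suc)
    eq = begin
      (+ 1 + x) ^ p - (+ 1 + x ^ p)                                    ≡⟨ cong (_- (+ 1 + x ^ p)) (trans (binomial x p) (sum-shift (suc n) term)) ⟩
      + 1 * + 1 + (sumUpTo n (term ∘ suc) + + (p C p) * x ^ p) - (+ 1 + x ^ p) ≡⟨ cong (λ c → + 1 * + 1 + (sumUpTo n (term ∘ suc) + + c * x ^ p) - (+ 1 + x ^ p)) (nCn≡1 p) ⟩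
      + 1 * + 1 + (sumUpTo n (term ∘ suc) + + 1 * x ^ p) - (+ 1 + x ^ p)      ≡⟨ lemma (sumUpTo n (term ∘ suc)) (x ^ p) ⟩
      sumUpTo n (term ∘ suc)                                          ∎

  -- `freshman` lets the claim pass between x and 1 + x in either direction, so induction from 0
  -- reaches the positive and the negative integers.
  fermat : ∀ p → Prime p → ∀ x → + p ∣ x ^ p - x
  fermat p pr = go
    where
    up : ∀ x → + p ∣ x ^ p - x → + p ∣ (+ 1 + x) ^ p - (+ 1 + x)
    up x p∣ = subst (+ p ∣_) (lemma ((+ 1 + x) ^ p) (x ^ p) x) (∣m∣n⇒∣m+n (freshman p pr x) p∣)
      where
      lemma : ∀ a b x → a - (+ 1 + b) + (b - x) ≡ a - (+ 1 + x)
      lemma = solve-∀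
    down : ∀ x → + p ∣ (+ 1 + x) ^ p - (+ 1 + x) → + p ∣ x ^ p - x
    down x p∣ = subst (+ p ∣_) (lemma ((+ 1 + x) ^ p) (x ^ p) x) (∣m∣n⇒∣m-n p∣ (freshman p pr x))
      where
      lemma : ∀ a b x → a - (+ 1 + x) - (a - (+ 1 + b)) ≡ b - x
      lemma = solve-∀
    at-0 : ∀ n .{{_ : NonZero n}} → (+ 0) ^ n - + 0 ≡ + 0
    at-0 (suc n) = refl
    go : ∀ x → + p ∣ x ^ p - x
    go (+ zero)     = divides (+ 0) (at-0 p {{prime⇒nonZero pr}})
    go (+ suc n)    = up (+ n) (go (+ n))
    go -[1+ zero ]  = down -[1+ 0 ] (go (+ 0))
    go -[1+ suc n ] = down -[1+ suc n ] (go -[1+ n ])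

  -- The explicit formula

  -- coef n j is, up to sign, the coefficient of x^(n - j) in the Dickson polynomial of degree n + j.
  coef : ℕ → ℕ → ℕ
  coef zero    j       = 0
  coef (suc n) zero    = 1
  coef (suc n) (suc j) = (suc n C suc j) ℕ.+ (n C j)

  -- With k = n + 1 + j this shows that the division in `dicksonCoef` is exact; it follows from
  -- absorption applied to the second binomial of `coef`.
  coef-quotient : ∀ n j → coef (suc n) j ℕ.* suc n ≡ (suc n ℕ.+ j) ℕ.* (suc n C j)
  coef-quotient n zero    = lemma n
    where
    lemma : ∀ n → 1 ℕ.* suc n ≡ (suc n ℕ.+ 0) ℕ.* 1
    lemma = solve-∀ℕ
  coef-quotient n (suc j) = begin
    (a ℕ.+ (n C j)) ℕ.* suc n              ≡⟨ lemma a (n C j) n ⟩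
    suc n ℕ.* a ℕ.+ suc n ℕ.* (n C j)      ≡⟨ cong (suc n ℕ.* a ℕ.+_) (absorption n j) ⟨
    suc n ℕ.* a ℕ.+ suc j ℕ.* a            ≡⟨ ℕ.*-distribʳ-+ a (suc n) (suc j) ⟨
    (suc n ℕ.+ suc j) ℕ.* a                ∎
    where
    open ≡-Reasoning
    a : ℕ
    a = suc n C suc j
    lemma : ∀ a b n → (a ℕ.+ b) ℕ.* suc n ≡ suc n ℕ.* a ℕ.+ suc n ℕ.* b
    lemma = solve-∀ℕ

  m∸n≡1+o⇒m≡1+o+n : ∀ m n {o} → m ℕ.∸ n ≡ suc o → m ≡ suc o ℕ.+ n
  m∸n≡1+o⇒m≡1+o+n m       zero    eq = trans eq (sym (ℕ.+-identityʳ _))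
  m∸n≡1+o⇒m≡1+o+n (suc m) (suc n) eq = trans (cong suc (m∸n≡1+o⇒m≡1+o+n m n eq)) (sym (ℕ.+-suc _ n))

  dicksonCoef≡coef : ∀ k j → dicksonCoef k j ≡ coef (k ℕ.∸ j) j
  dicksonCoef≡coef k j with k ℕ.∸ j in eq
  -- The default value 0 of `dicksonCoef` agrees with the first clause of `coef`.
  ... | zero  = refl
  ... | suc m = begin
    (k ℕ.* ((k ℕ.∸ j) C j)) ℕ./ suc m          ≡⟨ cong (λ x → (k ℕ.* (x C j)) ℕ./ suc m) eq ⟩
    (k ℕ.* (suc m C j)) ℕ./ suc m              ≡⟨ cong (λ x → (x ℕ.* (suc m C j)) ℕ./ suc m) k≡ ⟩
    ((suc m ℕ.+ j) ℕ.* (suc m C j)) ℕ./ suc m  ≡⟨ cong (ℕ._/ suc m) (coef-quotient m j) ⟨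
    (coef (suc m) j ℕ.* suc m) ℕ./ suc m       ≡⟨ ℕ.m*n/n≡m (coef (suc m) j) (suc m) ⟩
    coef (suc m) j                             ∎
    where
    open ≡-Reasoning
    k≡ : k ≡ suc m ℕ.+ j
    k≡ = m∸n≡1+o⇒m≡1+o+n k j eq

  coef-vanish : ∀ n j → n ℕ.< j → coef n j ≡ 0
  coef-vanish zero    j       _             = refl
  coef-vanish (suc n) (suc j) (ℕ.s≤s n<j) = cong₂ ℕ._+_ (k>n⇒nCk≡0 (ℕ.s≤s n<j)) (k>n⇒nCk≡0 n<j)

  -- The excluded case n = j = 0 is the constant term of degree 2: there `coef 1 1` is 2, coming
  -- from V_0 = 2, while `coef 0 0` has the default value 0.
  coef-pascal : ∀ n j → (n ≡ 0 → j ≢ 0) → coef (suc n) (suc j) ≡ coef n (suc j) ℕ.+ coef n j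
  coef-pascal zero    zero    ok = ⊥-elim (ok refl refl)
  coef-pascal zero    (suc j) ok = coef-vanish 1 (suc (suc j)) (ℕ.s≤s (ℕ.s≤s ℕ.z≤n))
  coef-pascal (suc n) zero    ok = begin
    (suc (suc n) C 1) ℕ.+ 1                ≡⟨ cong (ℕ._+ 1) (nC1≡n (suc (suc n))) ⟩
    suc (suc n) ℕ.+ 1                      ≡⟨ cong (ℕ._+ 1) (ℕ.+-comm (suc n) 1) ⟨
    suc n ℕ.+ 1 ℕ.+ 1                      ≡⟨ cong (λ x → x ℕ.+ 1 ℕ.+ 1) (nC1≡n (suc n)) ⟨
    (suc n C 1) ℕ.+ 1 ℕ.+ 1                ∎
    where open ≡-Reasoning
  coef-pascal (suc n) (suc j) ok = begin
    (suc (suc n) C suc (suc j)) ℕ.+ (suc n C suc j)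
      ≡⟨ cong₂ ℕ._+_ (nCk+nC[k+1]≡[n+1]C[k+1] (suc n) (suc j)) (nCk+nC[k+1]≡[n+1]C[k+1] n j) ⟨
    (a ℕ.+ b) ℕ.+ (c ℕ.+ d)
      ≡⟨ lemma a b c d ⟩
    (b ℕ.+ d) ℕ.+ (a ℕ.+ c) ∎
    where
    open ≡-Reasoning
    a b c d : ℕ
    a = suc n C suc j
    b = suc n C suc (suc j)
    c = n C j
    d = n C suc j
    lemma : ∀ a b c d → (a ℕ.+ b) ℕ.+ (c ℕ.+ d) ≡ (b ℕ.+ d) ℕ.+ (a ℕ.+ c)
    lemma = solve-∀ℕ

  dicksonCoef-pascal : ∀ k j → dicksonCoef (suc (suc (suc k))) (suc j)
                               ≡ dicksonCoef (suc (suc k)) (suc j) ℕ.+ dicksonCoef (suc k) j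
  dicksonCoef-pascal k j = begin
    dicksonCoef (suc (suc (suc k))) (suc j)                   ≡⟨ dicksonCoef≡coef (suc (suc (suc k))) (suc j) ⟩
    coef (suc (suc k) ℕ.∸ j) (suc j)                          ≡⟨ step ⟩
    coef (suc k ℕ.∸ j) (suc j) ℕ.+ coef (suc k ℕ.∸ j) j       ≡⟨ cong₂ ℕ._+_ (dicksonCoef≡coef (suc (suc k)) (suc j)) (dicksonCoef≡coef (suc k) j) ⟨
    dicksonCoef (suc (suc k)) (suc j) ℕ.+ dicksonCoef (suc k) j ∎
    where
    open ≡-Reasoning
    step : coef (suc (suc k) ℕ.∸ j) (suc j) ≡ coef (suc k ℕ.∸ j) (suc j) ℕ.+ coef (suc k ℕ.∸ j) j
    step with j ℕ.≤? suc k
    -- If j = 0 the upper argument is `suc k`, so the exceptional case of `coef-pascal` does not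
    -- arise.
    ... | yes j≤1+k = trans (cong (λ n → coef n (suc j)) (ℕ.+-∸-assoc 1 j≤1+k))
                        (coef-pascal (suc k ℕ.∸ j) j (λ { e refl → ℕ.1+n≢0 e }))
    ... | no j≰1+k = begin
      coef (suc (suc k) ℕ.∸ j) (suc j)                      ≡⟨ cong (λ n → coef n (suc j)) (ℕ.m≤n⇒m∸n≡0 (ℕ.≰⇒> j≰1+k)) ⟩
      0                                                     ≡⟨ cong (λ n → coef n (suc j) ℕ.+ coef n j) (ℕ.m≤n⇒m∸n≡0 (ℕ.<⇒≤ (ℕ.≰⇒> j≰1+k))) ⟨
      coef (suc k ℕ.∸ j) (suc j) ℕ.+ coef (suc k ℕ.∸ j) j   ∎

  dicksonCoef-vanish : ∀ k j → k ℕ.< 2 ℕ.* j → dicksonCoef k j ≡ 0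
  dicksonCoef-vanish k (suc j) k<2j = trans (dicksonCoef≡coef k (suc j)) (coef-vanish (k ℕ.∸ suc j) (suc j)
    (ℕ.m<n+o⇒m∸n<o k (suc j) (subst (λ i → k ℕ.< suc j ℕ.+ i) (ℕ.+-identityʳ (suc j)) k<2j)))

  module _ (x : ℤ) where

    dicksonTerm : ℕ → ℕ → ℤ
    dicksonTerm k j = ((- ℤ.1ℤ) ^ j) * (+ dicksonCoef k j) * (x ^ (k ℕ.∸ 2 ℕ.* j))

    -- The three members of the recurrence have different summation bounds; since terms beyond k/2
    -- vanish, they can all be rewritten with bounds that match.
    D-any-bound : ∀ k N → k ℕ.≤ N → D k x ≡ sumUpTo N (dicksonTerm k)
    D-any-bound k N k≤N = sym (sum-truncate N (dicksonTerm k) (ℕ.≤-trans (ℕ.m/n≤m k 2) k≤N) vanish)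
      where
      lemma : ∀ s y → s * + 0 * y ≡ + 0
      lemma = solve-∀
      vanish : ∀ j → k ℕ./ 2 ℕ.< j → dicksonTerm k j ≡ + 0
      vanish j k/2<j = trans (cong (λ c → ((- ℤ.1ℤ) ^ j) * (+ c) * (x ^ (k ℕ.∸ 2 ℕ.* j))) (dicksonCoef-vanish k j k<2j))
                             (lemma ((- ℤ.1ℤ) ^ j) (x ^ (k ℕ.∸ 2 ℕ.* j)))
        where
        k<2j : k ℕ.< 2 ℕ.* j
        k<2j = ℕ.≰⇒> λ 2j≤k → ℕ.<⇒≱ k/2<j
          (subst (ℕ._≤ k ℕ./ 2) (trans (cong (ℕ._/ 2) (ℕ.*-comm 2 j)) (ℕ.m*n/n≡m j 2)) (ℕ./-monoˡ-≤ 2 2j≤k))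

    dicksonTerm-recurrence : ∀ k j → dicksonTerm (suc (suc (suc k))) (suc j)
      ≡ x * dicksonTerm (suc (suc k)) (suc j) + (- ℤ.1ℤ) * dicksonTerm (suc k) j
    dicksonTerm-recurrence k j = begin
      (- ℤ.1ℤ) * s * + dicksonCoef (suc (suc (suc k))) (suc j) * (x ^ (suc (suc (suc k)) ℕ.∸ 2 ℕ.* suc j))
        ≡⟨ cong₂ (λ c n → (- ℤ.1ℤ) * s * + c * (x ^ n)) (dicksonCoef-pascal k j) (cong (suc (suc (suc k)) ℕ.∸_) (ℕ.*-suc 2 j)) ⟩
      (- ℤ.1ℤ) * s * + (a ℕ.+ b) * y
        ≡⟨ cong (λ c → (- ℤ.1ℤ) * s * c * y) (ℤ.pos-+ a b) ⟩
      (- ℤ.1ℤ) * s * (+ a + + b) * y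
        ≡⟨ expand s (+ a) (+ b) y ⟩
      (- ℤ.1ℤ) * s * (+ a * y) + (- ℤ.1ℤ) * (s * + b * y)
        ≡⟨ cong (λ z → (- ℤ.1ℤ) * s * z + (- ℤ.1ℤ) * (s * + b * y)) power ⟩
      (- ℤ.1ℤ) * s * (+ a * (x * x ^ (suc (suc k) ℕ.∸ 2 ℕ.* suc j))) + (- ℤ.1ℤ) * (s * + b * y)
        ≡⟨ rearrange s (+ a) x (x ^ (suc (suc k) ℕ.∸ 2 ℕ.* suc j)) ((- ℤ.1ℤ) * (s * + b * y)) ⟩
      x * ((- ℤ.1ℤ) * s * + a * x ^ (suc (suc k) ℕ.∸ 2 ℕ.* suc j)) + (- ℤ.1ℤ) * (s * + b * y) ∎
      where
      open ≡-Reasoning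
      a b : ℕ
      a = dicksonCoef (suc (suc k)) (suc j)
      b = dicksonCoef (suc k) j
      s y : ℤ
      s = (- ℤ.1ℤ) ^ j
      y = x ^ (suc k ℕ.∸ 2 ℕ.* j)
      expand : ∀ s a b y → (- ℤ.1ℤ) * s * (a + b) * y ≡ (- ℤ.1ℤ) * s * (a * y) + (- ℤ.1ℤ) * (s * b * y)
      expand = solve-∀
      rearrange : ∀ s a x y z → (- ℤ.1ℤ) * s * (a * (x * y)) + z ≡ x * ((- ℤ.1ℤ) * s * a * y) + z
      rearrange = solve-∀
      -- The exponents differ by one only as long as the subtraction is not truncated. Where it is,
      -- the coefficient `a` is zero.
      power : + a * y ≡ + a * (x * x ^ (suc (suc k) ℕ.∸ 2 ℕ.* suc j))
      power with 2 ℕ.* suc j ℕ.≤? suc (suc k)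
      ... | yes le = cong (λ n → + a * x ^ n)
                       (trans (cong (suc (suc (suc k)) ℕ.∸_) (sym (ℕ.*-suc 2 j))) (ℕ.+-∸-assoc 1 le))
      ... | no  gt rewrite dicksonCoef-vanish (suc (suc k)) (suc j) (ℕ.≰⇒> gt) = trans (ℤ.*-zeroˡ y) (sym (ℤ.*-zeroˡ (x * x ^ (suc (suc k) ℕ.∸ 2 ℕ.* suc j))))

    dicksonTerm-0 : ∀ k → dicksonTerm (suc k) 0 ≡ x ^ suc k
    dicksonTerm-0 k = trans (cong (λ c → + 1 * + c * x ^ suc k) (dicksonCoef≡coef (suc k) 0)) (ℤ.*-identityˡ (x ^ suc k))

    D-recurrence : ∀ k → D (suc (suc (suc k))) x ≡ x * D (suc (suc k)) x - D (suc k) x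
    D-recurrence k = begin
      D (suc (suc (suc k))) x
        ≡⟨ D-any-bound (suc (suc (suc k))) (suc (suc (suc k))) ℕ.≤-refl ⟩
      sumUpTo (suc N) (dicksonTerm (suc (suc (suc k))))
        ≡⟨ sum-shift N (dicksonTerm (suc (suc (suc k)))) ⟩
      dicksonTerm (suc (suc (suc k))) 0 + sumUpTo N (dicksonTerm (suc (suc (suc k))) ∘ suc)
        ≡⟨ cong₂ _+_ (trans (dicksonTerm-0 (suc (suc k))) (cong (x *_) (sym (dicksonTerm-0 (suc k)))))
                     (trans (sum-cong N (dicksonTerm-recurrence k)) (sum-linear N x (- ℤ.1ℤ) (dicksonTerm (suc (suc k)) ∘ suc) (dicksonTerm (suc k)))) ⟩
      x * t + (x * s + (- ℤ.1ℤ) * sumUpTo N (dicksonTerm (suc k)))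
        ≡⟨ lemma x t s (sumUpTo N (dicksonTerm (suc k))) ⟩
      x * (t + s) - sumUpTo N (dicksonTerm (suc k))
        ≡⟨ cong₂ (λ a b → x * a - b) (sym (sum-shift N (dicksonTerm (suc (suc k))))) (sym (D-any-bound (suc k) N (ℕ.n≤1+n _))) ⟩
      x * sumUpTo (suc N) (dicksonTerm (suc (suc k))) - D (suc k) x
        ≡⟨ cong (λ a → x * a - D (suc k) x) (sym (D-any-bound (suc (suc k)) (suc N) (ℕ.n≤1+n _))) ⟩
      x * D (suc (suc k)) x - D (suc k) x ∎
      where
      open ≡-Reasoning
      N : ℕ
      N = suc (suc k)
      t s : ℤ
      t = dicksonTerm (suc (suc k)) 0
      s = sumUpTo N (dicksonTerm (suc (suc k)) ∘ suc)
      lemma : ∀ x t s r → x * t + (x * s + (- ℤ.1ℤ) * r) ≡ x * (t + s) - r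
      lemma = solve-∀

    -- Only positive indices are compared: `D 0 x` evaluates to 0 through the default coefficient,
    -- whereas `V x 0` is 2. Degrees 1 and 2 are the base cases of the recurrence.
    D≡V : ∀ k → D (suc k) x ≡ V x (suc k)
    D≡V zero          = lemma x
      where
      lemma : ∀ x → + 1 * + 1 * (x * + 1) ≡ x
      lemma = solve-∀
    D≡V (suc zero)    = lemma x
      where
      lemma : ∀ x → + 1 * + 1 * (x * (x * + 1)) + (- ℤ.1ℤ) * + 1 * + 2 * + 1 ≡ x * x - + 2
      lemma = solve-∀
    D≡V (suc (suc k)) = trans (D-recurrence k) (cong₂ (λ a b → x * a - b) (D≡V (suc k)) (D≡V k))

  -- Writing N = n + 1 and p = N + j + 1, `coef-quotient` makes N times the coefficient a multiple
  -- of `p`, and 0 < N < p allows N to be cancelled.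
  prime∣coef : ∀ n j → Prime (suc n ℕ.+ suc j) → suc n ℕ.+ suc j ℕ.∣ coef (suc n) (suc j)
  prime∣coef n j pr = prime-∣-cancel (suc n) (coef (suc n) (suc j)) pr (λ ()) (ℕ.m<m+n (suc n) (ℕ.s≤s ℕ.z≤n))
    (subst (suc n ℕ.+ suc j ℕ.∣_) (trans (sym (coef-quotient n (suc j))) (ℕ.*-comm (coef (suc n) (suc j)) (suc n)))
      (ℕ.m∣m*n (suc n C suc j)))

  prime∣dicksonCoef : ∀ p j → Prime p → p ℕ.∣ dicksonCoef p (suc j)
  prime∣dicksonCoef p j pr = subst (p ℕ.∣_) (sym (dicksonCoef≡coef p (suc j))) (go (p ℕ.∸ suc j) refl)
    where
    go : ∀ n → p ℕ.∸ suc j ≡ n → p ℕ.∣ coef n (suc j)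
    go zero    _  = ℕ._∣0 p
    go (suc n) eq = subst (ℕ._∣ coef (suc n) (suc j)) (sym p≡) (prime∣coef n j (subst Prime p≡ pr))
      where
      p≡ : p ≡ suc n ℕ.+ suc j
      p≡ = m∸n≡1+o⇒m≡1+o+n p (suc j) eq

  -- Modulo `p` only the leading term x^p of the Dickson polynomial survives, and Fermat reduces it
  -- to x.
  V-prime : ∀ p → Prime p → ∀ x → + p ∣ V x p - x
  V-prime (suc n) pr x = subst (+ p ∣_) eq (∣m∣n⇒∣m+n (fermat p pr x) (sum-∣ n p∣term))
    where
    open ≡-Reasoning
    p : ℕ
    p = suc n
    p∣term : ∀ j → j ℕ.≤ n → + p ∣ dicksonTerm x p (suc j)
    p∣term j _ = ∣m⇒∣m*n (x ^ (p ℕ.∸ 2 ℕ.* suc j)) (∣n⇒∣m*n ((- ℤ.1ℤ) ^ suc j) (pos-∣ (prime∣dicksonCoef p j pr)))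
    lemma : ∀ y x s → y - x + s ≡ y + s - x
    lemma = solve-∀
    eq : x ^ p - x + sumUpTo n (dicksonTerm x p ∘ suc) ≡ V x p - x
    eq = begin
      x ^ p - x + sumUpTo n (dicksonTerm x p ∘ suc)              ≡⟨ lemma (x ^ p) x (sumUpTo n (dicksonTerm x p ∘ suc)) ⟩
      x ^ p + sumUpTo n (dicksonTerm x p ∘ suc) - x              ≡⟨ cong (λ y → y + sumUpTo n (dicksonTerm x p ∘ suc) - x) (dicksonTerm-0 x n) ⟨
      dicksonTerm x p 0 + sumUpTo n (dicksonTerm x p ∘ suc) - x  ≡⟨ cong (_- x) (sum-shift n (dicksonTerm x p)) ⟨
      sumUpTo p (dicksonTerm x p) - x                            ≡⟨ cong (_- x) (D-any-bound x p p ℕ.≤-refl) ⟨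
      D p x - x                                                  ≡⟨ cong (_- x) (D≡V x n) ⟩
      V x p - x                                                  ∎

  -- Divisibility and parity over the integers

  *-mono-∣ : ∀ {a b x y : ℤ} → a ∣ x → b ∣ y → a * b ∣ x * y
  *-mono-∣ {b = b} {x = x} a∣x b∣y = ∣-trans (*-monoˡ-∣ b a∣x) (*-monoʳ-∣ x b∣y)

  euclid-ℤ : ∀ {p} x y → Prime p → + p ∣ x * y → + p ∣ x ⊎ + p ∣ y
  euclid-ℤ {p} x y pr p∣xy =
    map ∣ᵤ⇒∣ ∣ᵤ⇒∣ (euclidsLemma ℤ.∣ x ∣ ℤ.∣ y ∣ pr (subst (p ℕ.∣_) (ℤ.abs-* x y) (∣⇒∣ᵤ p∣xy)))

  even-or-odd : ∀ n → ∃ λ j → n ≡ j ℕ.* 2 ⊎ n ≡ suc (j ℕ.* 2)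
  even-or-odd zero = 0 , inj₁ refl
  even-or-odd (suc n) with even-or-odd n
  ... | j , inj₁ eq = j , inj₂ (cong suc eq)
  ... | j , inj₂ eq = suc j , inj₁ (cong suc eq)

  even-or-odd-ℤ : ∀ u → ∃ λ v → u ≡ + 2 * v ⊎ u ≡ + 2 * v + + 1
  even-or-odd-ℤ u with u %ℕ 2 | n%ℕd<d u 2 | a≡a%ℕn+[a/ℕn]*n u 2
  ... | 0 | _ | eq = u /ℕ 2 , inj₁ (trans eq (lemma (u /ℕ 2)))
    where
    lemma : ∀ v → + 0 + v * + 2 ≡ + 2 * v
    lemma = solve-∀
  ... | 1 | _ | eq = u /ℕ 2 , inj₂ (trans eq (lemma (u /ℕ 2)))
    where
    lemma : ∀ v → + 1 + v * + 2 ≡ + 2 * v + + 1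
    lemma = solve-∀
  ... | suc (suc _) | ℕ.s≤s (ℕ.s≤s ()) | _

  period-from-half : ∀ (q : ℤ) u m k → q ∣ (u * u - + 4) * U u (m ℕ.+ k) * U u m →
                     q ∣ V u (2 ℕ.* m ℕ.+ k) - V u k
  period-from-half q u m k q∣ = subst (q ∣_) (sym eq) q∣
    where
    open ≡-Reasoning
    eq : V u (2 ℕ.* m ℕ.+ k) - V u k ≡ (u * u - + 4) * U u (m ℕ.+ k) * U u m
    eq = begin
      V u (2 ℕ.* m ℕ.+ k) - V u k      ≡⟨ cong (λ n → V u n - V u k) (trans (cong (λ x → m ℕ.+ x ℕ.+ k) (ℕ.+-identityʳ m)) (ℕ.+-assoc m m k)) ⟩
      V u (m ℕ.+ (m ℕ.+ k)) - V u k    ≡⟨ V-difference u m k ⟩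
      (u * u - + 4) * U u (m ℕ.+ k) * U u m ∎

  ∣-insert : ∀ {q : ℤ} c x y → q ∣ c * y → q ∣ c * x * y
  ∣-insert {q} c x y q∣ = subst (q ∣_) (lemma c x y) (∣n⇒∣m*n x q∣)
    where
    lemma : ∀ c x y → x * (c * y) ≡ c * x * y
    lemma = solve-∀

  -- For x = U_{h+1} and y = U_h it is not known which factor `p` divides; passing to a common
  -- multiple `z` makes the answer uniform in `u`.
  prime-∣-common-multiple : ∀ {p} c x y {z} → Prime p → + p ∣ c * x * y → x ∣ z → y ∣ z → + p ∣ c * z
  prime-∣-common-multiple c x y pr p∣ x∣z y∣z with euclid-ℤ (c * x) y pr p∣
  ... | inj₁ p∣cx = ∣-trans p∣cx (*-monoʳ-∣ c x∣z)
  ... | inj₂ p∣y  = ∣n⇒∣m*n c (∣-trans p∣y y∣z)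

  -- Odd prime powers

  module _ (h p : ℕ) (p≡1+2h : p ≡ suc (h ℕ.+ h)) (pr : Prime p) (u : ℤ) where

    private
      c : ℤ
      c = u * u - + 4

    p∣cU-half : + p ∣ V u p - u → + p ∣ c * U u (suc h ℕ.* h)
    p∣cU-half p∣ = prime-∣-common-multiple c (U u (suc h)) (U u h) pr (subst (+ p ∣_) eq p∣)
        (subst (λ n → U u (suc h) ∣ U u n) (ℕ.*-comm h (suc h)) (U∣U-* u (suc h) h)) (U∣U-* u h (suc h))
      where
      open ≡-Reasoning
      eq : V u p - u ≡ c * U u (suc h) * U u h
      eq = begin
        -- Since p = h + (h + 1), the difference formula applies with m = h and k = 1.
        V u p - u                        ≡⟨ cong (λ n → V u n - u) (trans p≡1+2h (trans (sym (ℕ.+-suc h h)) (cong (h ℕ.+_) (sym (ℕ.+-comm h 1))))) ⟩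
        V u (h ℕ.+ (h ℕ.+ 1)) - V u 1    ≡⟨ V-difference u h 1 ⟩
        c * U u (h ℕ.+ 1) * U u h        ≡⟨ cong (λ n → c * U u n * U u h) (ℕ.+-comm h 1) ⟩
        c * U u (suc h) * U u h          ∎

    -- Modulo p the argument V u m of U p satisfies v² ≡ 4, so U v p ≡ p ≡ 0.
    p∣U-p : ∀ m → + p ∣ c * U u m → + p ∣ U (V u m) p
    p∣U-p m p∣ = subst (+ p ∣_) (lemma (U (V u m) p) (+ p))
      (∣m∣n⇒∣m+n (∣-trans (subst (+ p ∣_) (sym (V²-4 u m)) (∣m⇒∣m*n (U u m) p∣)) V²-4∣) ∣-refl)
      where
      lemma : ∀ x y → x - y + y ≡ x
      lemma = solve-∀
      V²-4∣ : (V u m * V u m - + 4) ∣ (U (V u m) p - + p)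
      V²-4∣ = subst (λ n → (V u m * V u m - + 4) ∣ (U (V u m) n - + n)) (sym p≡1+2h) (u²-4∣U-odd (V u m) h)

    -- Passing from m to pm multiplies U_m by `U (V u m) p`, which `p∣U-p` shows to be divisible by
    -- `p`; the condition of `p∣U-p` is a weakening of the induction hypothesis.
    p^∣cU : + p ∣ V u p - u → ∀ f → + (p ℕ.^ suc f) ∣ c * U u (p ℕ.^ f ℕ.* (suc h ℕ.* h))
    p^∣cU p∣ zero = subst (λ n → + (p ℕ.^ 1) ∣ c * U u n) (sym (ℕ.*-identityˡ (suc h ℕ.* h)))
      (subst (λ n → + n ∣ c * U u (suc h ℕ.* h)) (sym (ℕ.*-identityʳ p)) (p∣cU-half p∣))
    p^∣cU p∣ (suc f) = ∣-trans (∣-reflexive (trans (ℤ.pos-* p (p ℕ.^ suc f)) (ℤ.*-comm (+ p) (+ (p ℕ.^ suc f)))))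
      (subst (+ (p ℕ.^ suc f) * + p ∣_) eq (*-mono-∣ IH (p∣U-p m (∣-trans (pos-∣ (ℕ.m∣m*n (p ℕ.^ f))) IH))))
      where
      m : ℕ
      m = p ℕ.^ f ℕ.* (suc h ℕ.* h)
      IH : + (p ℕ.^ suc f) ∣ c * U u m
      IH = p^∣cU p∣ f
      eq : c * U u m * U (V u m) p ≡ c * U u (p ℕ.^ suc f ℕ.* (suc h ℕ.* h))
      eq = trans (ℤ.*-assoc c _ _) (cong (c *_) (trans (sym (U-* u m p)) (cong (U u) (sym (ℕ.*-assoc p (p ℕ.^ f) (suc h ℕ.* h))))))

    V-period-odd : + p ∣ V u p - u → ∀ f k →
                   + (p ℕ.^ suc f) ∣ V u (2 ℕ.* (p ℕ.^ f ℕ.* (suc h ℕ.* h)) ℕ.+ k) - V u k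
    V-period-odd p∣ f k = period-from-half (+ (p ℕ.^ suc f)) u (p ℕ.^ f ℕ.* (suc h ℕ.* h)) k
      (∣-insert c (U u (p ℕ.^ f ℕ.* (suc h ℕ.* h) ℕ.+ k)) (U u (p ℕ.^ f ℕ.* (suc h ℕ.* h))) (p^∣cU p∣ f))

  -- Powers of two

  2∣consecutive : ∀ v → + 2 ∣ v * (v + + 1)
  2∣consecutive v with even-or-odd-ℤ v
  ... | w , inj₁ refl = divides (w * (+ 2 * w + + 1)) (lemma w)
    where
    lemma : ∀ w → (+ 2 * w) * (+ 2 * w + + 1) ≡ w * (+ 2 * w + + 1) * + 2
    lemma = solve-∀
  ... | w , inj₂ refl = divides ((+ 2 * w + + 1) * (w + + 1)) (lemma w)
    where
    lemma : ∀ w → (+ 2 * w + + 1) * (+ 2 * w + + 1 + + 1) ≡ (+ 2 * w + + 1) * (w + + 1) * + 2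
    lemma = solve-∀

  8∣odd²-1 : ∀ v → let u = + 2 * v + + 1 in + 8 ∣ u * u - + 1
  8∣odd²-1 v = subst (+ 8 ∣_) (lemma v) (*-monoʳ-∣ (+ 4) (2∣consecutive v))
    where
    lemma : ∀ v → + 4 * (v * (v + + 1)) ≡ (+ 2 * v + + 1) * (+ 2 * v + + 1) - + 1
    lemma = solve-∀

  16∣[even²-4]*even : ∀ v → let u = + 2 * v in + 16 ∣ (u * u - + 4) * u
  16∣[even²-4]*even v = subst (+ 16 ∣_) (lemma v) (*-monoʳ-∣ (+ 8) (∣m⇒∣m*n (v - + 1) (2∣consecutive v)))
    where
    lemma : ∀ v → + 8 * (v * (v + + 1) * (v - + 1)) ≡ (+ 2 * v * (+ 2 * v) - + 4) * (+ 2 * v)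
    lemma = solve-∀

  2∣V-even : ∀ v n → + 2 ∣ V (+ 2 * v) n
  2∣V-even v zero          = ∣-refl
  2∣V-even v (suc zero)    = ∣m⇒∣m*n v ∣-refl
  2∣V-even v (suc (suc n)) = ∣m∣n⇒∣m-n (∣n⇒∣m*n (+ 2 * v) (2∣V-even v (suc n))) (2∣V-even v n)

  -- For even u all values of V are even. For odd u the difference factors as (u + 1) ((u - 1)
  -- V_{k+1} - V_k), and u + 1 is even.
  V-period-2 : ∀ u k → + 2 ∣ V u (3 ℕ.+ k) - V u k
  V-period-2 u k with even-or-odd-ℤ u
  ... | v , inj₁ refl = ∣m∣n⇒∣m-n (2∣V-even v (3 ℕ.+ k)) (2∣V-even v k)
  ... | v , inj₂ refl =
    divides ((v + + 1) * (+ 2 * v * V u (suc k) - V u k)) (lemma v (V u k) (V u (suc k)))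
    where
    lemma : ∀ v a b → let u = + 2 * v + + 1 in
            u * (u * b - a) - b - a ≡ ((v + + 1) * (+ 2 * v * b - a)) * + 2
    lemma = solve-∀

  2∣V-3n : ∀ u n → + 2 ∣ V u (n ℕ.* 3)
  2∣V-3n u zero    = ∣-refl
  2∣V-3n u (suc n) = subst (+ 2 ∣_) (lemma (V u (3 ℕ.+ n ℕ.* 3)) (V u (n ℕ.* 3)))
    (∣m∣n⇒∣m+n (V-period-2 u (n ℕ.* 3)) (2∣V-3n u n))
    where
    lemma : ∀ x y → x - y + y ≡ x
    lemma = solve-∀

  -- U_{2m} = U_m V_m, and V_m is even because 3 divides m. The factor `c` is 1 for odd u and u² - 4
  -- for even u.
  U-doubling-∣ : ∀ {q} u c n → + q ∣ c * U u (n ℕ.* 3) → + (2 ℕ.* q) ∣ c * U u (2 ℕ.* n ℕ.* 3)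
  U-doubling-∣ {q} u c n q∣ = ∣-trans (∣-reflexive (trans (ℤ.pos-* 2 q) (ℤ.*-comm (+ 2) (+ q))))
    (subst (+ q * + 2 ∣_) eq (*-mono-∣ q∣ (2∣V-3n u n)))
    where
    m : ℕ
    m = n ℕ.* 3
    -- The expression `v * + 1 - + 0` is `U v 2` unfolded.
    lemma : ∀ c x v → c * x * v ≡ c * (x * (v * + 1 - + 0))
    lemma = solve-∀
    eq : c * U u m * V u m ≡ c * U u (2 ℕ.* n ℕ.* 3)
    eq = trans (lemma c (U u m) (V u m)) (cong (c *_) (trans (sym (U-* u m 2)) (cong (U u) (sym (ℕ.*-assoc 2 n 3)))))

  2^∣U-odd : ∀ v g → + (2 ℕ.^ (3 ℕ.+ g)) ∣ + 1 * U (+ 2 * v + + 1) (2 ℕ.^ g ℕ.* 3)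
  2^∣U-odd v zero    = subst (+ 8 ∣_) (lemma (+ 2 * v + + 1)) (8∣odd²-1 v)
    where
    lemma : ∀ u → u * u - + 1 ≡ + 1 * (u * (u * + 1 - + 0) - + 1)
    lemma = solve-∀
  2^∣U-odd v (suc g) = U-doubling-∣ (+ 2 * v + + 1) (+ 1) (2 ℕ.^ g) (2^∣U-odd v g)

  -- The induction starts at index 6: at index 3 the factor U_3 = u² - 1 is odd and u² - 4
  -- guarantees only a factor 4.
  2^∣cU-even : ∀ v g → let u = + 2 * v in
               + (2 ℕ.^ (4 ℕ.+ g)) ∣ (u * u - + 4) * U u (2 ℕ.^ suc g ℕ.* 3)
  2^∣cU-even v zero    = subst (+ 16 ∣_) (lemma (+ 2 * v)) (∣m⇒∣m*n ((u * u - + 1) * (u * u - + 3)) (16∣[even²-4]*even v))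
    where
    u : ℤ
    u = + 2 * v
    -- Here `t`, `f`, `g` are U_3, U_4, U_5 unfolded, and the identity rests on U_6 = u (u² - 1) (u²
    -- - 3).
    lemma : ∀ u → let t = u * (u * + 1 - + 0) - + 1; f = u * t - (u * + 1 - + 0); g = u * f - t in
            (u * u - + 4) * u * ((u * u - + 1) * (u * u - + 3)) ≡ (u * u - + 4) * (u * g - f)
    lemma = solve-∀
  2^∣cU-even v (suc g) = U-doubling-∣ (+ 2 * v) (+ 2 * v * (+ 2 * v) - + 4) (2 ℕ.^ suc g) (2^∣cU-even v g)

  -- The half period is 3. For even u the factor u² - 4 is divisible by 4, for odd u the factor U_3
  -- = u² - 1 is divisible by 8.
  V-period-4 : ∀ u k → + 4 ∣ V u (6 ℕ.+ k) - V u k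
  V-period-4 u k = period-from-half (+ 4) u 3 k lem
    where
    U₃ : ∀ u → u * u - + 1 ≡ u * (u * + 1 - + 0) - + 1
    U₃ = solve-∀
    4∣u²-4 : ∀ v → + 2 * v * (+ 2 * v) - + 4 ≡ (v * v - + 1) * + 4
    4∣u²-4 = solve-∀
    lem : + 4 ∣ (u * u - + 4) * U u (3 ℕ.+ k) * U u 3
    lem with even-or-odd-ℤ u
    ... | v , inj₁ refl = ∣m⇒∣m*n (U u 3) (∣m⇒∣m*n (U u (3 ℕ.+ k)) (divides (v * v - + 1) (4∣u²-4 v)))
    ... | v , inj₂ refl = ∣n⇒∣m*n ((u * u - + 4) * U u (3 ℕ.+ k))
                            (∣-trans (divides (+ 2) refl) (subst (+ 8 ∣_) (U₃ u) (8∣odd²-1 v)))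

  -- For g = 0 the oddness of k matters: m + k is even, so U_{m+k} is a multiple of U_2 = u, and (u²
  -- - 4) u is divisible by 16. For larger g the factor (u² - 4) U_m is already divisible enough.
  2^∣cUU-even : ∀ v g j → let u = + 2 * v; m = 2 ℕ.^ g ℕ.* 3; k = suc (j ℕ.* 2) in
                + (2 ℕ.^ (3 ℕ.+ g)) ∣ (u * u - + 4) * U u (m ℕ.+ k) * U u m
  2^∣cUU-even v zero j = ∣m⇒∣m*n (U u 3) (∣-trans (∣-trans (divides (+ 2) refl) (16∣[even²-4]*even v))
      (*-monoʳ-∣ (u * u - + 4) (subst (_∣ U u (4 ℕ.+ j ℕ.* 2)) (u*1-0 u) (U∣U-* u 2 (2 ℕ.+ j)))))
    where
    u : ℤ
    u = + 2 * v
    u*1-0 : ∀ u → u * + 1 - + 0 ≡ u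
    u*1-0 = solve-∀
  2^∣cUU-even v (suc g) j = ∣-insert (u * u - + 4) (U u (m ℕ.+ suc (j ℕ.* 2))) (U u m)
      (2^∣cU-even v g)
    where
    u : ℤ
    u = + 2 * v
    m : ℕ
    m = 2 ℕ.^ suc g ℕ.* 3

  -- The index k must be odd: V 0 6 = -2 and V 0 0 = 2 are not congruent modulo 8.
  V-period-2^ : ∀ u g j → let k = suc (j ℕ.* 2) in
                + (2 ℕ.^ (3 ℕ.+ g)) ∣ V u (2 ℕ.* (2 ℕ.^ g ℕ.* 3) ℕ.+ k) - V u k
  V-period-2^ u g j = period-from-half (+ (2 ℕ.^ (3 ℕ.+ g))) u m k lem
    where
    k m : ℕ
    k = suc (j ℕ.* 2)
    m = 2 ℕ.^ g ℕ.* 3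
    lem : + (2 ℕ.^ (3 ℕ.+ g)) ∣ (u * u - + 4) * U u (m ℕ.+ k) * U u m
    lem with even-or-odd-ℤ u
    ... | v , inj₁ refl = 2^∣cUU-even v g j
    ... | v , inj₂ refl = ∣n⇒∣m*n ((u * u - + 4) * U u (m ℕ.+ k))
                            (subst (+ (2 ℕ.^ (3 ℕ.+ g)) ∣_) (ℤ.*-identityˡ (U u m)) (2^∣U-odd v g))

  -- Congruences and coprimality

  modℤ-sym : ∀ {m} a b → a ≡ b [modℤ m ] → b ≡ a [modℤ m ]
  modℤ-sym {m} a b a≡b = subst (m ℕ.∣_) (ℤ.∣i-j∣≡∣j-i∣ a b) a≡b

  modℤ-trans : ∀ {m} a b c → a ≡ b [modℤ m ] → b ≡ c [modℤ m ] → a ≡ c [modℤ m ]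
  modℤ-trans {m} a b c a≡b b≡c = ∣⇒∣ᵤ (subst (+ m ∣_) (lemma a b c)
      (∣m∣n⇒∣m+n {m = a - b} {n = b - c} (∣ᵤ⇒∣ a≡b) (∣ᵤ⇒∣ b≡c)))
    where
    lemma : ∀ a b c → a - b + (b - c) ≡ a - c
    lemma = solve-∀

  %-modℕ : ∀ x m .{{_ : NonZero m}} → (x ℕ.% m) ≡ x [modℕ m ]
  %-modℕ x m = modℤ-sym {m} (+ x) (+ (x ℕ.% m)) (∣⇒∣ᵤ (divides (+ (x ℕ./ m)) eq))
    where
    open ≡-Reasoning
    lemma : ∀ r a → r + a - r ≡ a
    lemma = solve-∀
    eq : + x - + (x ℕ.% m) ≡ + (x ℕ./ m) * + m
    eq = begin
      + x - + (x ℕ.% m)                                     ≡⟨ cong (λ y → + y - + (x ℕ.% m)) (ℕ.m≡m%n+[m/n]*n x m) ⟩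
      + (x ℕ.% m ℕ.+ x ℕ./ m ℕ.* m) - + (x ℕ.% m)           ≡⟨ cong (_- + (x ℕ.% m)) (trans (ℤ.pos-+ (x ℕ.% m) _) (cong (_+_ (+ (x ℕ.% m))) (ℤ.pos-* (x ℕ./ m) m))) ⟩
      + (x ℕ.% m) + + (x ℕ./ m) * + m - + (x ℕ.% m)         ≡⟨ lemma (+ (x ℕ.% m)) (+ (x ℕ./ m) * + m) ⟩
      + (x ℕ./ m) * + m                                     ∎

  modℕ⇒∣∸ : ∀ {m a b} → a ℕ.≤ b → a ≡ b [modℕ m ] → m ℕ.∣ b ℕ.∸ a
  modℕ⇒∣∸ {m} {a} {b} a≤b a≡b =
    subst (m ℕ.∣_) (trans (cong ℤ.∣_∣ (ℤ.[+m]-[+n]≡m⊖n a b)) (ℤ.∣⊖∣-≤ a≤b)) a≡b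

  modℕ-unique-≤ : ∀ {m a b} → a ℕ.≤ b → b ℕ.< m → a ≡ b [modℕ m ] → a ≡ b
  modℕ-unique-≤ {m} {a} {b} a≤b b<m a≡b with b ℕ.≤? a
  ... | yes b≤a = ℕ.≤-antisym a≤b b≤a
  ... | no  b≰a = ⊥-elim (ℕ.<⇒≱ b<m (ℕ.≤-trans (ℕ.∣⇒≤ {{b∸a≢0}} (modℕ⇒∣∸ a≤b a≡b)) (ℕ.m∸n≤m b a)))
    where
    b∸a≢0 : NonZero (b ℕ.∸ a)
    b∸a≢0 = ℕ.>-nonZero (ℕ.m<n⇒0<n∸m (ℕ.≰⇒> b≰a))

  modℕ-unique : ∀ {m a b} → a ℕ.< m → b ℕ.< m → a ≡ b [modℕ m ] → a ≡ b
  modℕ-unique {m} {a} {b} a<m b<m a≡b with ℕ.≤-total a b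
  ... | inj₁ a≤b = modℕ-unique-≤ a≤b b<m a≡b
  ... | inj₂ b≤a = sym (modℕ-unique-≤ b≤a a<m (modℤ-sym {m} (+ a) (+ b) a≡b))

  coprime-modℕ : ∀ {m} a b → a ≡ b [modℕ m ] → Coprime b m → Coprime a m
  coprime-modℕ {m} a b a≡b b⊥m {d} (d∣a , d∣m) = b⊥m (∣⇒∣ᵤ d∣b , d∣m)
    where
    lemma : ∀ a b → a - (a - b) ≡ b
    lemma = solve-∀
    d∣b : + d ∣ + b
    d∣b = subst (+ d ∣_) (lemma (+ a) (+ b))
      (∣m∣n⇒∣m-n {m = + a} {n = + a - + b} (pos-∣ d∣a) (∣ᵤ⇒∣ (ℕ.∣-trans d∣m a≡b)))

  coprime-∣ : ∀ {a b c} → c ℕ.∣ b → Coprime a b → Coprime a c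
  coprime-∣ c∣b a⊥b (d∣a , d∣c) = a⊥b (d∣a , ℕ.∣-trans d∣c c∣b)

  coprime-* : ∀ {a b c} → Coprime a b → Coprime a c → Coprime a (b ℕ.* c)
  coprime-* a⊥b a⊥c {d} (d∣a , d∣bc) =
    a⊥c (d∣a , coprime-divisor (λ (e∣d , e∣b) → a⊥b (ℕ.∣-trans e∣d d∣a , e∣b)) d∣bc)

  coprime-^ : ∀ {a b} n → Coprime a b → Coprime a (b ℕ.^ n)
  coprime-^ zero    a⊥b (_ , d∣1) = ℕ.∣1⇒≡1 d∣1
  coprime-^ (suc n) a⊥b = coprime-* a⊥b (coprime-^ n a⊥b)

  distinct-primes-coprime : ∀ {p q} → Prime p → Prime q → p ≢ q → Coprime p q
  distinct-primes-coprime pr qr p≢q (d∣p , d∣q) with prime⇒irreducible pr d∣p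
  ... | inj₁ d≡1 = d≡1
  ... | inj₂ refl with prime⇒irreducible qr d∣q
  ...   | inj₁ refl = refl
  ...   | inj₂ refl = ⊥-elim (p≢q refl)

  prime-powers-coprime : ∀ {p q} m n → Prime p → Prime q → p ≢ q → Coprime (p ℕ.^ m) (q ℕ.^ n)
  prime-powers-coprime m n pr qr p≢q =
    coprime-^ n (Coprimality.sym (coprime-^ m (Coprimality.sym (distinct-primes-coprime pr qr p≢q))))

  -- Products and least common multiples of families

  ∣prodF : ∀ m f i → f i ℕ.∣ prodF m f
  ∣prodF (suc m) f zero    = ℕ.m∣m*n (prodF m (f ∘ suc))
  ∣prodF (suc m) f (suc i) = ℕ.∣n⇒∣m*n (f zero) (∣prodF m (f ∘ suc) i)

  coprime-prodF : ∀ {x} m f → (∀ i → Coprime x (f i)) → Coprime x (prodF m f)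
  coprime-prodF zero    f x⊥f (_ , d∣1) = ℕ.∣1⇒≡1 d∣1
  coprime-prodF (suc m) f x⊥f = coprime-* (x⊥f zero) (coprime-prodF m (f ∘ suc) (x⊥f ∘ suc))

  prodF-least : ∀ m f → (∀ i j → i ≢ j → Coprime (f i) (f j)) → ∀ {c} → (∀ i → f i ℕ.∣ c) → prodF m f ℕ.∣ c
  prodF-least zero    f ⊥f {c} f∣c = ℕ.1∣ c
  prodF-least (suc m) f ⊥f {c} f∣c with prodF-least m (f ∘ suc) (λ i j i≢j → ⊥f (suc i) (suc j) (i≢j ∘ Fin.suc-injective)) (f∣c ∘ suc)
  -- Now c = q * P, and `f zero` is coprime to P, so it divides q.
  ... | ℕ.divides q refl = ℕ.*-monoˡ-∣ P (coprime-divisor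
          (coprime-prodF m (f ∘ suc) (λ i → ⊥f zero (suc i) (λ ()))) (subst (f zero ℕ.∣_) (ℕ.*-comm q P) (f∣c zero)))
    where
    P : ℕ
    P = prodF m (f ∘ suc)

  ∣lcmF : ∀ m f i → f i ℕ.∣ lcmF m f
  ∣lcmF (suc m) f zero    = m∣lcm[m,n] (f zero) (lcmF m (f ∘ suc))
  ∣lcmF (suc m) f (suc i) = ℕ.∣-trans (∣lcmF m (f ∘ suc) i) (n∣lcm[m,n] (f zero) (lcmF m (f ∘ suc)))

  lcmF-least : ∀ m f {c} → (∀ i → f i ℕ.∣ c) → lcmF m f ℕ.∣ c
  lcmF-least zero    f {c} f∣c = ℕ.1∣ c
  lcmF-least (suc m) f f∣c = lcm-least (f∣c zero) (lcmF-least m (f ∘ suc) (f∣c ∘ suc))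

  -- Coprimality and being nonzero are easy for products; this carries them over to the least common
  -- multiple.
  lcmF∣prodF : ∀ m f → lcmF m f ℕ.∣ prodF m f
  lcmF∣prodF m f = lcmF-least m f (∣prodF m f)

  prodF≢0 : ∀ m f → (∀ i → NonZero (f i)) → NonZero (prodF m f)
  prodF≢0 zero    f f≢0 = _
  prodF≢0 (suc m) f f≢0 = ℕ.m*n≢0 (f zero) (prodF m (f ∘ suc)) {{f≢0 zero}} {{prodF≢0 m (f ∘ suc) (f≢0 ∘ suc)}}

  lcmF≢0 : ∀ m f → (∀ i → NonZero (f i)) → NonZero (lcmF m f)
  lcmF≢0 m f f≢0 = ℕ.≢-nonZero λ lcm≡0 →
    ℕ.≢-nonZero⁻¹ (prodF m f) {{prodF≢0 m f f≢0}} (ℕ.0∣⇒≡0 (subst (ℕ._∣ prodF m f) lcm≡0 (lcmF∣prodF m f)))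

  -- Periods of the Dickson polynomials

  -- The period is required only at indices coprime to L, because modulo 8 and higher powers of two
  -- it can fail at even indices. The bound 1 < L keeps 0 from being coprime to L, so that `D` and
  -- `V` agree at every index considered.
  record DicksonPeriod (q L : ℕ) : Set where
    field
      nontrivial : 1 ℕ.< L
      V-period   : ∀ u k → Coprime k L → + q ∣ V u (L ℕ.+ k) - V u k

    nonZero : NonZero L
    nonZero = ℕ.>-nonZero (ℕ.<-trans (ℕ.s≤s ℕ.z≤n) nontrivial)

    coprime-shift : ∀ c k → Coprime k L → Coprime (c ℕ.* L ℕ.+ k) L
    coprime-shift zero    k k⊥L = k⊥L
    coprime-shift (suc c) k k⊥L = subst (λ n → Coprime n L) (sym (ℕ.+-assoc L (c ℕ.* L) k)) (coprime-+ (coprime-shift c k k⊥L))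

    V-periods : ∀ u c k → Coprime k L → + q ∣ V u (c ℕ.* L ℕ.+ k) - V u k
    V-periods u zero    k k⊥L = divides (+ 0) (ℤ.+-inverseʳ (V u k))
    V-periods u (suc c) k k⊥L = subst (+ q ∣_) eq
        (∣m∣n⇒∣m+n (V-period u (c ℕ.* L ℕ.+ k) (coprime-shift c k k⊥L)) (V-periods u c k k⊥L))
      where
      lemma : ∀ a b c → a - b + (b - c) ≡ a - c
      lemma = solve-∀
      eq : V u (L ℕ.+ (c ℕ.* L ℕ.+ k)) - V u (c ℕ.* L ℕ.+ k) + (V u (c ℕ.* L ℕ.+ k) - V u k)
           ≡ V u (suc c ℕ.* L ℕ.+ k) - V u k
      eq = trans (lemma (V u (L ℕ.+ (c ℕ.* L ℕ.+ k))) (V u (c ℕ.* L ℕ.+ k)) (V u k))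
                 (cong (λ n → V u n - V u k) (sym (ℕ.+-assoc L (c ℕ.* L) k)))

    D≡V-coprime : ∀ k → Coprime k L → ∀ u → D k u ≡ V u k
    D≡V-coprime (suc k) _   u = D≡V u k
    D≡V-coprime zero    0⊥L u = ⊥-elim (ℕ.<⇒≢ nontrivial (sym (0⊥L (L ℕ.∣0 , ℕ.∣-refl))))

    D-period-≤ : ∀ k k′ → k ℕ.≤ k′ → Coprime k L → Coprime k′ L → k ≡ k′ [modℕ L ] →
                 ∀ u → D k′ u ≡ D k u [modℤ q ]
    D-period-≤ k k′ k≤k′ k⊥L k′⊥L k≡k′ u with modℕ⇒∣∸ {L} k≤k′ k≡k′
    ... | ℕ.divides c eq = ∣⇒∣ᵤ (subst (+ q ∣_) (cong₂ _-_ (trans (cong (V u) k′≡) (sym (D≡V-coprime k′ k′⊥L u))) (sym (D≡V-coprime k k⊥L u)))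
                             (V-periods u c k k⊥L))
      where
      k′≡ : c ℕ.* L ℕ.+ k ≡ k′
      k′≡ = trans (cong (ℕ._+ k) (sym eq)) (ℕ.m∸n+n≡m k≤k′)

    D-period : ∀ k k′ → Coprime k′ L → k ≡ k′ [modℕ L ] → ∀ u → D k u ≡ D k′ u [modℤ q ]
    D-period k k′ k′⊥L k≡k′ u with ℕ.≤-total k k′
    ... | inj₁ k≤k′ = modℤ-sym {q} (D k′ u) (D k u) (D-period-≤ k k′ k≤k′ (coprime-modℕ k k′ k≡k′ k′⊥L) k′⊥L k≡k′ u)
    ... | inj₂ k′≤k = D-period-≤ k′ k k′≤k k′⊥L (coprime-modℕ k k′ k≡k′ k′⊥L) (modℤ-sym {L} (+ k) (+ k′) k≡k′) u

  -- The left side is what `p * p ∸ 1` reduces to for p = 2h + 1; the right side is arranged for an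
  -- exact division by 2.
  odd²-1 : ∀ h → (h ℕ.+ h) ℕ.+ (h ℕ.+ h) ℕ.* suc (h ℕ.+ h) ≡ 2 ℕ.* (suc h ℕ.* h) ℕ.* 2
  odd²-1 = solve-∀ℕ

  odd-prime-power-period : ∀ p f → Prime p → ¬ (2 ℕ.∣ p) → 1 ℕ.≤ f → DicksonPeriod (p ℕ.^ f) (lp p f)
  odd-prime-power-period p (suc f) pr 2∤p _ with even-or-odd p
  ... | h , inj₁ p≡2h = ⊥-elim (2∤p (ℕ.divides h p≡2h))
  ... | h , inj₂ p≡1+h*2 = subst (DicksonPeriod (p ℕ.^ suc f)) L≡ (record
      { nontrivial = ℕ.≤-trans (ℕ.s≤s (ℕ.s≤s ℕ.z≤n)) (ℕ.m≤m*n 2 (p ℕ.^ f ℕ.* half) {{ℕ.m*n≢0 (p ℕ.^ f) half {{p^f≢0}} {{half≢0 h p≡1+h*2}}}})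
      ; V-period   = λ u k _ → V-period-odd h p p≡1+2h pr u (V-prime p pr u) f k })
    where
    half : ℕ
    half = suc h ℕ.* h
    p≡1+2h : p ≡ suc (h ℕ.+ h)
    p≡1+2h = trans p≡1+h*2 (cong suc (trans (ℕ.*-comm h 2) (cong (h ℕ.+_) (ℕ.+-identityʳ h))))
    p^f≢0 : NonZero (p ℕ.^ f)
    p^f≢0 = ℕ.m^n≢0 p f {{subst NonZero (sym p≡1+2h) _}}
    half≢0 : ∀ h → p ≡ suc (h ℕ.* 2) → NonZero (suc h ℕ.* h)
    half≢0 zero    p≡1 = ⊥-elim (¬prime[1] (subst Prime p≡1 pr))
    half≢0 (suc h) _   = _
    swap : ∀ x y → 2 ℕ.* (x ℕ.* y) ≡ x ℕ.* (2 ℕ.* y)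
    swap = solve-∀ℕ
    [p²-1]/2 : (p ℕ.* p ℕ.∸ 1) ℕ./ 2 ≡ 2 ℕ.* half
    [p²-1]/2 = trans (cong (λ p → (p ℕ.* p ℕ.∸ 1) ℕ./ 2) p≡1+2h) (trans (cong (ℕ._/ 2) (odd²-1 h)) (ℕ.m*n/n≡m (2 ℕ.* half) 2))
    L≡ : 2 ℕ.* (p ℕ.^ f ℕ.* half) ≡ lp p (suc f)
    L≡ = trans (swap (p ℕ.^ f) half) (cong (p ℕ.^ f ℕ.*_) (sym [p²-1]/2))

  two-power-period : ∀ e → DicksonPeriod (2 ℕ.^ suc e) (l0 (suc e))
  two-power-period 0 = record { nontrivial = ℕ.s≤s (ℕ.s≤s ℕ.z≤n) ; V-period = λ u k _ → V-period-2 u k }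
  two-power-period 1 = record { nontrivial = ℕ.s≤s (ℕ.s≤s ℕ.z≤n) ; V-period = λ u k _ → V-period-4 u k }
  two-power-period (suc (suc g)) = record
      { nontrivial = ℕ.≤-trans (ℕ.s≤s (ℕ.s≤s ℕ.z≤n)) (ℕ.m≤m*n 3 (2 ℕ.^ suc g) {{ℕ.m^n≢0 2 (suc g)}})
      ; V-period   = period }
    where
    L : ℕ
    L = 3 ℕ.* 2 ℕ.^ suc g
    swap : ∀ x → 2 ℕ.* (x ℕ.* 3) ≡ 3 ℕ.* (2 ℕ.* x)
    swap = solve-∀ℕ
    period : ∀ u k → Coprime k L → + (2 ℕ.^ (3 ℕ.+ g)) ∣ V u (L ℕ.+ k) - V u k
    period u k k⊥L with even-or-odd k
    -- An even k would share the factor 2 with L.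
    ... | j , inj₁ k≡2j = ⊥-elim (2≢1 (k⊥L (ℕ.divides j k≡2j , ℕ.∣n⇒∣m*n 3 (ℕ.m∣m*n (2 ℕ.^ g)))))
      where
      2≢1 : 2 ≢ 1
      2≢1 ()
    ... | j , inj₂ refl = subst (λ n → + (2 ℕ.^ (3 ℕ.+ g)) ∣ V u (n ℕ.+ k) - V u k) (swap (2 ℕ.^ g)) (V-period-2^ u g j)

  -- Gluing residues

  -- Elements of `A` and `K` also carry proofs, and those of `A` a chosen solution. Injectivity and
  -- surjectivity therefore compare only the residues, and the first clause makes the value
  -- independent of the chosen solution.
  Bijection : (m : ℕ) (q L : Fin m → ℕ) (N W : ℕ) → Set
  Bijection m q L N W = Σ (A m q L → K N W) λ ρ →
    (∀ (α : A m q L) (x : ℕ) → Solves m L (proj₁ α) x → proj₁ (ρ α) ≡ x [modℕ W ])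
    × (∀ (α β : A m q L) → proj₁ (ρ α) ≡ proj₁ (ρ β) → ∀ i → proj₁ α i ≡ proj₁ β i)
    × (∀ (κ : K N W) → Σ (A m q L) λ α → proj₁ (ρ α) ≡ proj₁ κ)

  -- `N` and `W` enter only through divisibility properties of a least common multiple, which makes
  -- e = 0 and e ≥ 1 instances of one argument.
  module _ {m : ℕ} (q L : Fin m → ℕ) (N W : ℕ)
           (period : ∀ i → DicksonPeriod (q i) (L i))
           (q∣N : ∀ i → q i ℕ.∣ N) (N-least : ∀ {c} → (∀ i → q i ℕ.∣ c) → N ℕ.∣ c)
           (L∣W : ∀ i → L i ℕ.∣ W) (W-least : ∀ {c} → (∀ i → L i ℕ.∣ c) → W ℕ.∣ c)
           (coprime-W : ∀ {x} → (∀ i → Coprime x (L i)) → Coprime x W)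
           (W≢0 : NonZero W) where

    private
      instance
        _ = W≢0

    residue-≡ : ∀ (α : A m q L) x → Solves m L (proj₁ α) x → ∀ i → (x ℕ.% W) ≡ proj₁ α i [modℕ L i ]
    residue-≡ (a , _) x sol i =
      modℤ-trans {L i} (+ (x ℕ.% W)) (+ x) (+ a i) (ℕ.∣-trans (L∣W i) (%-modℕ x W)) (sol i)

    -- Modulo each q_i periodicity replaces the index by a_i, which fixes every u; the congruences
    -- then combine modulo `N`.
    residue-kernel : ∀ (α : A m q L) x → Solves m L (proj₁ α) x → Kernel N W (x ℕ.% W)
    residue-kernel α@(a , ker , _) x sol = ℕ.m%n<n x W
      , coprime-W (λ i → coprime-modℕ (x ℕ.% W) (a i) (residue-≡ α x sol i) (proj₁ (proj₂ (ker i))))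
      , λ u → N-least (λ i → modℤ-trans {q i} (D (x ℕ.% W) u) (D (a i) u) u
          (DicksonPeriod.D-period (period i) (x ℕ.% W) (a i) (proj₁ (proj₂ (ker i))) (residue-≡ α x sol i) u)
          (proj₂ (proj₂ (ker i)) u))

    glue : A m q L → K N W
    glue α@(_ , _ , x , sol) = x ℕ.% W , residue-kernel α x sol

    -- Two solutions agree modulo every L_i, hence modulo `W`.
    glue-solution : ∀ (α : A m q L) x → Solves m L (proj₁ α) x → proj₁ (glue α) ≡ x [modℕ W ]
    glue-solution α@(a , _ , y , y-sol) x x-sol =
      modℤ-trans {W} (+ (y ℕ.% W)) (+ y) (+ x) (%-modℕ y W)
        (W-least (λ i → modℤ-trans {L i} (+ y) (+ a i) (+ x) (y-sol i) (modℤ-sym {L i} (+ x) (+ a i) (x-sol i))))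

    glue-injective : ∀ (α β : A m q L) → proj₁ (glue α) ≡ proj₁ (glue β) → ∀ i → proj₁ α i ≡ proj₁ β i
    glue-injective α@(a , a-ker , x , x-sol) β@(b , b-ker , y , y-sol) eq i =
      modℕ-unique {L i} (proj₁ (a-ker i)) (proj₁ (b-ker i))
        (modℤ-trans {L i} (+ a i) (+ (x ℕ.% W)) (+ b i)
          (modℤ-sym {L i} (+ (x ℕ.% W)) (+ a i) (residue-≡ α x x-sol i))
          (subst (λ k → k ≡ b i [modℕ L i ]) (sym eq) (residue-≡ β y y-sol i)))

    -- The kernel element k itself is stored as the solution of the system, so gluing returns
    -- `k % W`, which is k.
    restrict : K N W → A m q L
    restrict (k , k<W , k⊥W , fix) = a , ker , k , λ i → modℤ-sym {L i} (+ a i) (+ k) (a≡k i)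
      where
      a : Fin m → ℕ
      a i = ℕ._%_ k (L i) {{DicksonPeriod.nonZero (period i)}}
      a≡k : ∀ i → a i ≡ k [modℕ L i ]
      a≡k i = %-modℕ k (L i) {{DicksonPeriod.nonZero (period i)}}
      k⊥L : ∀ i → Coprime k (L i)
      k⊥L i = coprime-∣ (L∣W i) k⊥W
      ker : ∀ i → Kernel (q i) (L i) (a i)
      ker i = ℕ.m%n<n k (L i) {{DicksonPeriod.nonZero (period i)}}
            , coprime-modℕ (a i) k (a≡k i) (k⊥L i)
            , λ u → modℤ-trans {q i} (D (a i) u) (D k u) u
                      (DicksonPeriod.D-period (period i) (a i) k (k⊥L i) (a≡k i) u)
                      (ℕ.∣-trans (q∣N i) (fix u))

    glue-restrict : ∀ (κ : K N W) → proj₁ (glue (restrict κ)) ≡ proj₁ κ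
    glue-restrict (k , k<W , _) = ℕ.m<n⇒m%n≡m k<W

    glue-bijection : Bijection m q L N W
    glue-bijection = glue , glue-solution , glue-injective , λ κ → restrict κ , glue-restrict κ

  -- The cases e = 0 and e ≥ 1

  module _ {r : ℕ} (p es : Fin r → ℕ) (pr : ∀ i → Prime (p i)) (2∤p : ∀ i → ¬ (2 ℕ.∣ p i))
           (p-injective : Injective _≡_ _≡_ p) (es≥1 : ∀ i → 1 ℕ.≤ es i) where

    private
      q L : Fin r → ℕ
      q i = p i ℕ.^ es i
      L i = lp (p i) (es i)

    q-coprime : ∀ i j → i ≢ j → Coprime (q i) (q j)
    q-coprime i j i≢j = prime-powers-coprime (es i) (es j) (pr i) (pr j) (i≢j ∘ p-injective)

    period : ∀ i → DicksonPeriod (q i) (L i)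
    period i = odd-prime-power-period (p i) (es i) (pr i) (2∤p i) (es≥1 i)

    bijection-odd : Bijection r q L (nOf 0 r p es) (w 0 r p es)
    bijection-odd = glue-bijection q L (nOf 0 r p es) (w 0 r p es) period
      -- The factor 1 here and in the next argument is the power 2^0 in `nOf`.
      (λ i → ℕ.∣n⇒∣m*n 1 (∣prodF r q i))
      (λ {c} q∣c → subst (ℕ._∣ c) (sym (ℕ.*-identityˡ (prodF r q))) (prodF-least r q q-coprime q∣c))
      (∣lcmF r L) (lcmF-least r L)
      (λ x⊥L → coprime-∣ (lcmF∣prodF r L) (coprime-prodF r L x⊥L))
      (lcmF≢0 r L (λ i → DicksonPeriod.nonZero (period i)))

    -- Putting the prime 2 in front of the family works because `nOf` and `w` at a successor unfold
    -- to the product and the least common multiple of the extended families.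
    bijection-even : ∀ e → Bijection (suc r) (2 ℕ.^ suc e ∷ q) (l0 (suc e) ∷ L) (nOf (suc e) r p es) (w (suc e) r p es)
    bijection-even e = glue-bijection q₀ L₀ (nOf (suc e) r p es) (w (suc e) r p es) period₀
      (∣prodF (suc r) q₀) (prodF-least (suc r) q₀ q₀-coprime)
      (∣lcmF (suc r) L₀) (lcmF-least (suc r) L₀)
      (λ x⊥L → coprime-∣ (lcmF∣prodF (suc r) L₀) (coprime-prodF (suc r) L₀ x⊥L))
      (lcmF≢0 (suc r) L₀ (λ i → DicksonPeriod.nonZero (period₀ i)))
      where
      q₀ L₀ : Fin (suc r) → ℕ
      q₀ = 2 ℕ.^ suc e ∷ q
      L₀ = l0 (suc e) ∷ L
      2≢p : ∀ i → 2 ≢ p i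
      2≢p i 2≡p = 2∤p i (subst (2 ℕ.∣_) 2≡p ℕ.∣-refl)
      q₀-coprime : ∀ i j → i ≢ j → Coprime (q₀ i) (q₀ j)
      q₀-coprime zero    zero    i≢j = ⊥-elim (i≢j refl)
      q₀-coprime zero    (suc j) _   = prime-powers-coprime (suc e) (es j) prime[2] (pr j) (2≢p j)
      q₀-coprime (suc i) zero    _   = prime-powers-coprime (es i) (suc e) (pr i) prime[2] (2≢p i ∘ sym)
      q₀-coprime (suc i) (suc j) i≢j = q-coprime i j (i≢j ∘ cong suc)
      period₀ : ∀ i → DicksonPeriod (q₀ i) (L₀ i)
      period₀ zero    = two-power-period e
      period₀ (suc i) = period i

open import Data.Nat using (ℕ; suc; _*_; _^_; _≤_; _∸_)
open import Data.Nat.Primality using (Prime)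
open import Data.Nat.Divisibility using (_∣_)
open import Data.Fin using (Fin)
open import Data.Vec.Functional using (_∷_)
open import Data.Product using (Σ; ∃; _×_; proj₁)
open import Function.Definitions using (Injective)
open import Relation.Nullary using (¬_)
open import Relation.Binary.PropositionalEquality using (_≡_)
open import Data.Nat using (s≤s)
open import Data.Product using (_,_)
open import Relation.Binary.PropositionalEquality using (refl)
open DicksonKernels using (bijection-odd; bijection-even)

theorem4p7 : (e r : ℕ) (p es : Fin r → ℕ) →
    (∀ i → Prime (p i)) → (∀ i → ¬ (2 ∣ p i)) → Injective _≡_ _≡_ p →
    (∀ i → 1 ≤ es i) → 2 ≤ nOf e r p es → (e ≡ 0 → 1 ≤ r) →
    (e ≡ 0 →
    Σ (A r (λ i → p i ^ es i) (λ i → lp (p i) (es i)) → K (nOf e r p es) (w e r p es)) λ ρ →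
    (∀ (α : A r (λ i → p i ^ es i) (λ i → lp (p i) (es i))) (x : ℕ) → Solves r (λ i → lp (p i) (es i)) (proj₁ α) x →
    proj₁ (ρ α) ≡ x [modℕ w e r p es ])
    × (∀ (α β : A r (λ i → p i ^ es i) (λ i → lp (p i) (es i))) → proj₁ (ρ α) ≡ proj₁ (ρ β) → ∀ i → proj₁ α i ≡ proj₁ β i)
    × (∀ (κ : K (nOf e r p es) (w e r p es)) → Σ (A r (λ i → p i ^ es i) (λ i → lp (p i) (es i))) λ α → proj₁ (ρ α) ≡ proj₁ κ))
    × (1 ≤ e →
    Σ (A (suc r) (2 ^ e ∷ (λ i → p i ^ es i)) (l0 e ∷ (λ i → lp (p i) (es i)))
    → K (nOf e r p es) (w e r p es)) λ ρ →
    (∀ (α : A (suc r) (2 ^ e ∷ (λ i → p i ^ es i)) (l0 e ∷ (λ i → lp (p i) (es i)))) (x : ℕ) → Solves (suc r) (l0 e ∷ (λ i → lp (p i) (es i))) (proj₁ α) x →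
    proj₁ (ρ α) ≡ x [modℕ w e r p es ])
    × (∀ (α β : A (suc r) (2 ^ e ∷ (λ i → p i ^ es i)) (l0 e ∷ (λ i → lp (p i) (es i)))) → proj₁ (ρ α) ≡ proj₁ (ρ β) → ∀ i → proj₁ α i ≡ proj₁ β i)
    × (∀ (κ : K (nOf e r p es) (w e r p es)) → Σ (A (suc r) (2 ^ e ∷ (λ i → p i ^ es i)) (l0 e ∷ (λ i → lp (p i) (es i)))) λ α → proj₁ (ρ α) ≡ proj₁ κ))
theorem4p7 e r p es pr 2∤p p-injective es≥1 _ _ =
    (λ { refl → bijection-odd p es pr 2∤p p-injective es≥1 })
  , (λ { (s≤s {n = e} _) → bijection-even p es pr 2∤p p-injective es≥1 e })
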